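{- There is a distributed algorithm in the CONGEST model that computes a $2$-approximation for unweighted TAP in $O(h)$ rounds, where $h$ is the height of the input tree $T$.
   Context: CONGEST model: network is an undirected connected $n$-vertex graph $G$; synchronous rounds, each vertex sends an $O(\log n)$-bit message per neighbour per round. Unweighted TAP: input is a $2$-edge-connected graph $G$ and a spanning tree $T$ of $G$ rooted at $r$, each vertex knowing its incident tree edges and its parent; the goal is a minimum-cardinality set $Aug$ of edges of $G$ such that $T\cup Aug$ is $2$-edge-connected; each vertex must know which incident edges are in $Aug$. The height $h$ of $T$ is the maximum root-to-vertex distance in $T$. -}

module Defs where

open import Data.Nat using (ℕ; zero; suc; _+_; _*_; _≤_; _<?_)
open import Data.Nat.Logarithm using (⌊log₂_⌋)
open import Data.Fin using (Fin; toℕ; _≟_)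
open import Data.Bool using (Bool; true; false; _∧_; _∨_; not)
open import Data.List using (List; []; _∷_; map; filter; length; concatMap)
open import Data.List.Relation.Unary.All using (All)
open import Data.Maybe using (Maybe; just; nothing)
open import Data.Product using (_×_; _,_; ∃; Σ)
open import Data.Fin.Base using (Fin)
open import Data.List.Base using (allFin)
open import Relation.Nullary using (¬_)
open import Relation.Nullary.Decidable using (⌊_⌋; does)
open import Relation.Binary.PropositionalEquality using (_≡_; _≢_)

-- Graphs on the vertex set Fin n, edge sets as symmetric Bool relations

EdgeSet : ℕ → Set
EdgeSet n = Fin n → Fin n → Bool

record IsSimpleGraph {n : ℕ} (G : EdgeSet n) : Set where
  field
    symmetric   : ∀ u v → G u v ≡ G v u
    irreflexive : ∀ v → G v v ≡ false

_⊆E_ : ∀ {n} → EdgeSet n → EdgeSet n → Set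
A ⊆E B = ∀ u v → A u v ≡ true → B u v ≡ true

_∪E_ : ∀ {n} → EdgeSet n → EdgeSet n → EdgeSet n
(A ∪E B) u v = A u v ∨ B u v

removeEdge : ∀ {n} → EdgeSet n → Fin n → Fin n → EdgeSet n
removeEdge H a b x y =
  H x y ∧ not ((does (x ≟ a) ∧ does (y ≟ b)) ∨ (does (x ≟ b) ∧ does (y ≟ a)))

data Reach {n : ℕ} (H : EdgeSet n) : Fin n → Fin n → Set where
  here  : ∀ {u} → Reach H u u
  there : ∀ {u w v} → H u w ≡ true → Reach H w v → Reach H u v

Connected : ∀ {n} → EdgeSet n → Set
Connected H = ∀ u v → Reach H u v

TwoEdgeConnected : ∀ {n} → EdgeSet n → Set
TwoEdgeConnected H =
  Connected H × (∀ a b → H a b ≡ true → Connected (removeEdge H a b))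

edgeCount : ∀ {n} → EdgeSet n → ℕ
edgeCount {n} A =
  length (filter (λ p → Data.Bool._≟_ (A (proj₁' p) (proj₂' p)) true)
    (concatMap (λ u → map (λ v → (u , v))
                        (filter (λ v → toℕ u <? toℕ v) (allFin n))) (allFin n)))
  where
  proj₁' : Fin n × Fin n → Fin n
  proj₁' (a , _) = a
  proj₂' : Fin n × Fin n → Fin n
  proj₂' (_ , b) = b

data Depth {n : ℕ} (parent : Fin n → Fin n) (r : Fin n) : Fin n → ℕ → Set where
  root : Depth parent r r 0
  step : ∀ {v d} → v ≢ r → Depth parent r (parent v) d → Depth parent r v (suc d)

record IsRootedSpanningTree {n : ℕ} (G : EdgeSet n) (r : Fin n)
                            (parent : Fin n → Fin n) : Set where
  field
    parent-root : parent r ≡ r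
    parent-edge : ∀ v → v ≢ r → G v (parent v) ≡ true
    reaches-root : ∀ v → ∃ λ d → Depth parent r v d

treeEdges : ∀ {n} → Fin n → (Fin n → Fin n) → EdgeSet n
treeEdges r parent u v =
  (not (does (u ≟ r)) ∧ does (parent u ≟ v)) ∨
  (not (does (v ≟ r)) ∧ does (parent v ≟ u))

IsHeight : ∀ {n} → Fin n → (Fin n → Fin n) → ℕ → Set
IsHeight r parent h =
  (∀ v d → Depth parent r v d → d ≤ h) × (∃ λ v → Depth parent r v h)

FeasibleAug : ∀ {n} → EdgeSet n → Fin n → (Fin n → Fin n) → EdgeSet n → Set
FeasibleAug G r parent A =
  (∀ u v → A u v ≡ A v u) × (A ⊆E G) × TwoEdgeConnected (treeEdges r parent ∪E A)

TwoApprox : ∀ {n} → EdgeSet n → Fin n → (Fin n → Fin n) → EdgeSet n → Set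
TwoApprox G r parent A =
  FeasibleAug G r parent A ×
  (∀ A' → FeasibleAug G r parent A' → edgeCount A ≤ 2 * edgeCount A')

-- identifiers: vertex v has ID toℕ v; messages are bit strings
Message : Set
Message = List Bool

-- local input of a vertex: n, own ID, list of neighbours (ID, is-tree-edge),
-- and the ID of its parent (nothing for the root)
record LocalInput : Set where
  constructor mkInput
  field
    numVertices : ℕ
    myId        : ℕ
    neighbours  : List (ℕ × Bool)
    parentId    : Maybe ℕ

-- A deterministic synchronous distributed algorithm with unbounded local
-- computation.  In each round a vertex sends to each neighbour (by ID) a
-- message computed from its state, then updates its state from the list of
-- (sender ID, message) pairs it received.  The output of a vertex is either
-- undecided (nothing) or a decision, for each neighbour ID, whether the
-- incident edge is in Aug.
record Algorithm : Set₁ where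
  field
    State  : Set
    init   : LocalInput → State
    send   : State → ℕ → Message
    update : State → List (ℕ × Message) → State
    output : State → Maybe (ℕ → Bool)

neighbourList : ∀ {n} → EdgeSet n → Fin n → List (Fin n)
neighbourList {n} G v = filter (λ u → Data.Bool._≟_ (G v u) true) (allFin n)

localInput : ∀ {n} → EdgeSet n → Fin n → (Fin n → Fin n) → Fin n → LocalInput
localInput {n} G r parent v =
  mkInput n (toℕ v)
    (map (λ u → (toℕ u , treeEdges r parent v u)) (neighbourList G v))
    (parentOf (v ≟ r))
  where
  parentOf : Relation.Nullary.Dec (v ≡ r) → Maybe ℕ
  parentOf (Relation.Nullary.yes _) = nothing
  parentOf (Relation.Nullary.no _)  = just (toℕ (parent v))

run : ∀ {n} (A : Algorithm) → EdgeSet n → Fin n → (Fin n → Fin n) →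
      ℕ → Fin n → Algorithm.State A
run A G r parent zero v = Algorithm.init A (localInput G r parent v)
run A G r parent (suc t) v =
  Algorithm.update A (run A G r parent t v)
    (map (λ u → (toℕ u , Algorithm.send A (run A G r parent t u) (toℕ v)))
         (neighbourList G v))

Bandwidth : ∀ {n} (A : Algorithm) → EdgeSet n → Fin n → (Fin n → Fin n) → ℕ → Set
Bandwidth {n} A G r parent B =
  ∀ t u v → G u v ≡ true →
    length (Algorithm.send A (run A G r parent t u) (toℕ v)) ≤ B * (⌊log₂ n ⌋ + 1)

Irrevocable : ∀ {n} (A : Algorithm) → EdgeSet n → Fin n → (Fin n → Fin n) → Set
Irrevocable A G r parent =
  ∀ t t' v o → t ≤ t' →
    Algorithm.output A (run A G r parent t v) ≡ just o →
    Algorithm.output A (run A G r parent t' v) ≡ just o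

SolvesBy : ∀ {n} (A : Algorithm) → EdgeSet n → Fin n → (Fin n → Fin n) → ℕ → Set
SolvesBy {n} A G r parent R =
  Σ (Fin n → (ℕ → Bool)) λ o →
    (∀ v → Algorithm.output A (run A G r parent R v) ≡ just (o v)) ×
    (∀ u v → G u v ≡ true → o u (toℕ v) ≡ o v (toℕ u)) ×
    TwoApprox G r parent (λ u v → G u v ∧ o u (toℕ v))

{-# OPTIONS --safe #-}

-- An edge {x , w} of an augmentation covers two vertical tree paths, one from each end up to the
-- lowest common ancestor. Treating each edge as two links (x , w) and (w , x), where (x , w) covers
-- the edge above v when v is an ancestor of x but not of w, the tree edges are processed bottom-up:
-- an edge not covered by a link chosen below it is critical, and chooses the link from its subtree
-- that reaches highest. Then no link covers two critical edges, so the number of chosen links is at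
-- most the number of links of any augmentation, which is twice its number of edges.
--
-- In the CONGEST model, every vertex forwards the names of its ancestors, one per round, to all its
-- neighbours, so after h rounds both ends of an edge know how high its links reach. All other
-- values are recomputed in every round from the neighbours' latest values, and stabilise first
-- upwards and then downwards along the tree. The height is detected by the root, which hears in
-- round t whether it has a descendant at distance t.

module Submission where

open import Defs
open import Data.Bool using (Bool; true; false; _∧_; _∨_; not; if_then_else_)
import Data.Bool as Bool
open import Data.Bool.Properties using (∨-comm; ∨-zeroʳ; ∧-zeroʳ; ∧-comm; ∧-conicalˡ; ∧-conicalʳ; T-≡)
open import Data.Empty using (⊥)
open import Data.Fin using (Fin; toℕ; _≟_)
open import Data.Fin.Properties using (toℕ-injective; toℕ<n; toℕ≤pred[n]; injective⇒≤)
open import Data.List using (List; []; _∷_; _++_; map; filter; length; concatMap; allFin; upTo)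
open import Data.Bool.ListAction using (any; or)
open import Data.List.Properties using (length-map; length-++; map-∘; map-cong-local)
open import Data.List.Membership.Propositional using (_∈_; find; lose)
open import Data.List.Membership.Propositional.Properties
  using (∈-∃++; ∈-++⁺ˡ; ∈-++⁺ʳ; ∈-++⁻; ∈-filter⁺; ∈-filter⁻; ∈-map⁺; ∈-map⁻; ∈-allFin; ∈-concatMap⁺; ∈-concatMap⁻; ∈-upTo⁺; ∈-upTo⁻)
open import Data.List.Relation.Unary.All as All using ()
import Data.List.Relation.Unary.All.Properties as All
open import Data.List.Relation.Unary.AllPairs as AllPairs using ([]; _∷_)
import Data.List.Relation.Unary.AllPairs.Properties as AllPairs
open import Data.List.Relation.Unary.Any using (here; there)
import Data.List.Relation.Unary.Any.Properties as Any
open import Data.List.Relation.Unary.Unique.Propositional using (Unique)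
import Data.List.Relation.Unary.Unique.Propositional.Properties as Unique
open import Data.Maybe using (Maybe; just; nothing; fromMaybe)
open import Data.Nat using (ℕ; zero; suc; pred; _+_; _*_; _∸_; _^_; _≤_; _<_; z≤n; s≤s; s≤s⁻¹; _<?_)
import Data.Nat as ℕ
open import Data.Nat.DivMod using (_/_; _%_; m%n<n; m≡m%n+[m/n]*n; m<n*o⇒m/o<n; m/n≤m; m/n*n≤m; m*n/n≡m)
open import Data.Nat.Logarithm using (⌊log₂_⌋; ⌊log₂⌋-mono-≤; ⌊log₂[2^n]⌋≡n)
open import Data.Nat.Properties hiding (_≟_)
open import Data.Product using (_×_; _,_; ∃; ∃₂; proj₁; proj₂; swap)
open import Data.Sum using (_⊎_; inj₁; inj₂)
import Data.Sum as Sum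
open import Function using (_∘_; Equivalence)
open import Relation.Binary using (tri<; tri≈; tri>)
open import Relation.Binary.PropositionalEquality
open import Relation.Nullary using (¬_; Dec; yes; no; contradiction; does; proof; ofʸ; ofⁿ)
open import Relation.Nullary.Decidable using (dec-true; dec-false; _×-dec_)

-- Counting

-- Pigeonhole for a relation in place of a function: the partner of the first element is taken out
-- of `ys`, and injectivity of `R` keeps it from being the partner of a later element.
length-≤ : ∀ {A B : Set} (R : A → B → Set) {xs : List A} → Unique xs → (ys : List B) →
           (∀ {x} → x ∈ xs → ∃ λ y → y ∈ ys × R x y) →
           (∀ {x x' y} → R x y → R x' y → x ≡ x') →
           length xs ≤ length ys
length-≤ R [] ys total injective = z≤n
length-≤ R {x ∷ xs} (x∉xs ∷ unique) ys total injective
  with total (here refl)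
... | y , y∈ys , Rxy with ∈-∃++ y∈ys
... | as , bs , refl = begin
  suc (length xs)             ≤⟨ s≤s (length-≤ R unique (as ++ bs) total' injective) ⟩
  suc (length (as ++ bs))     ≡⟨ cong suc (length-++ as) ⟩
  suc (length as + length bs) ≡⟨ +-suc (length as) (length bs) ⟨
  length as + length (y ∷ bs) ≡⟨ length-++ as ⟨
  length (as ++ y ∷ bs)       ∎
  where
  open ≤-Reasoning
  total' : ∀ {z} → z ∈ xs → ∃ λ w → w ∈ as ++ bs × R z w
  total' z∈xs with total (there z∈xs)
  ... | w , w∈ , Rzw with ∈-++⁻ as w∈
  ... | inj₁ w∈as         = w , ∈-++⁺ˡ w∈as , Rzw
  ... | inj₂ (there w∈bs) = w , ∈-++⁺ʳ as w∈bs , Rzw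
  ... | inj₂ (here refl)  = contradiction (injective Rxy Rzw) (All.lookup x∉xs z∈xs)

-- Repeats the list that `edgeCount` filters, so that `length (edgeList A)` and `edgeCount A` agree
-- by computation.
increasingPairs : ∀ n → List (Fin n × Fin n)
increasingPairs n =
  concatMap (λ u → map (u ,_) (filter (λ v → toℕ u <? toℕ v) (allFin n))) (allFin n)

edgeList : ∀ {n} → EdgeSet n → List (Fin n × Fin n)
edgeList {n} A = filter (λ p → A (proj₁ p) (proj₂ p) Bool.≟ true) (increasingPairs n)

edgeList-unique : ∀ {n} (A : EdgeSet n) → Unique (edgeList A)
edgeList-unique {n} A = Unique.filter⁺ _ (Unique.concat⁺
  (All.map⁺ (All.universal
    (λ u → Unique.map⁺ (cong proj₂) (Unique.filter⁺ _ (Unique.allFin⁺ n))) (allFin n)))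
  (AllPairs.map⁺ (AllPairs.map disjoint (Unique.allFin⁺ n))))
  where
  disjoint : ∀ {u u' : Fin n} {xs ys} → u ≢ u' →
             ∀ {p} → ¬ (p ∈ map (u ,_) xs × p ∈ map (u' ,_) ys)
  disjoint u≢u' (p∈ , p∈') with ∈-map⁻ _ p∈ | ∈-map⁻ _ p∈'
  ... | _ , _ , refl | _ , _ , refl = u≢u' refl

∈-edgeList⁻ : ∀ {n} (A : EdgeSet n) {u v} → (u , v) ∈ edgeList A → toℕ u < toℕ v × A u v ≡ true
∈-edgeList⁻ {n} A p∈ with ∈-filter⁻ _ {xs = increasingPairs n} p∈
... | p∈pairs , Auv with find (∈-concatMap⁻ _ {xs = allFin n} p∈pairs)
... | _ , _ , p∈map with ∈-map⁻ _ p∈map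
... | _ , v∈ , refl = proj₂ (∈-filter⁻ (λ v → toℕ _ <? toℕ v) {xs = allFin n} v∈) , Auv

∈-edgeList⁺ : ∀ {n} (A : EdgeSet n) {u v} → toℕ u < toℕ v → A u v ≡ true → (u , v) ∈ edgeList A
∈-edgeList⁺ {n} A {u} u<v Auv = ∈-filter⁺ _ (∈-concatMap⁺ _
  (lose (∈-allFin u) (∈-map⁺ _ (∈-filter⁺ _ (∈-allFin _) u<v)))) Auv

∈-orientedEdges : ∀ {n} (A : EdgeSet n) → (∀ u v → A u v ≡ A v u) → ∀ {u v} → u ≢ v → A u v ≡ true →
                  (u , v) ∈ edgeList A ++ map swap (edgeList A)
∈-orientedEdges A symmetric {u} {v} u≢v Auv with <-cmp (toℕ u) (toℕ v)
... | tri< u<v _ _ = ∈-++⁺ˡ (∈-edgeList⁺ A u<v Auv)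
... | tri≈ _ u≡v _ = contradiction (toℕ-injective u≡v) u≢v
... | tri> _ _ v<u =
  ∈-++⁺ʳ (edgeList A) (∈-map⁺ swap (∈-edgeList⁺ A v<u (trans (symmetric v u) Auv)))

-- The approximation factor 2 arises here: every edge of an augmentation provides two links.
length-orientedEdges : ∀ {n} (A : EdgeSet n) →
                       length (edgeList A ++ map swap (edgeList A)) ≡ 2 * edgeCount A
length-orientedEdges A = begin
  length (edgeList A ++ map swap (edgeList A))         ≡⟨ length-++ (edgeList A) ⟩
  length (edgeList A) + length (map swap (edgeList A)) ≡⟨ cong (length (edgeList A) +_) (length-map swap (edgeList A)) ⟩
  length (edgeList A) + length (edgeList A)            ≡⟨ cong (length (edgeList A) +_) (+-identityʳ _) ⟨
  2 * edgeCount A                                      ∎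
  where open ≡-Reasoning

-- Reachability

Symmetric : ∀ {n} → EdgeSet n → Set
Symmetric H = ∀ u v → H u v ≡ H v u

module _ {n : ℕ} {H : EdgeSet n} where

  reach-trans : ∀ {u v w} → Reach H u v → Reach H v w → Reach H u w
  reach-trans here        q = q
  reach-trans (there e p) q = there e (reach-trans p q)

  reach-sym : Symmetric H → ∀ {u v} → Reach H u v → Reach H v u
  reach-sym symmetric here                        = here
  reach-sym symmetric (there {u} {w} e p) =
    reach-trans (reach-sym symmetric p) (there (trans (symmetric w u) e) here)

  reach-exit : ∀ {P : Fin n → Set} → (∀ x → Dec (P x)) → ∀ {u w} → Reach H u w → P u → ¬ P w →
               ∃₂ λ x y → H x y ≡ true × P x × ¬ P y
  reach-exit P? here                pu ¬pw = contradiction pu ¬pw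
  reach-exit P? (there {w = y} e p) pu ¬pw with P? y
  ... | yes py = reach-exit P? p py ¬pw
  ... | no ¬py = _ , _ , e , pu , ¬py

module _ {n : ℕ} (H : EdgeSet n) (a b : Fin n) where

  removeEdge-⊆ : ∀ {x y} → removeEdge H a b x y ≡ true → H x y ≡ true
  removeEdge-⊆ e = ∧-conicalˡ _ _ e

  removeEdge-removed : ∀ {x y} → removeEdge H a b x y ≡ true → ¬ (x ≡ a × y ≡ b)
  removeEdge-removed {x} {y} e (x≡a , y≡b)
    with e' ← ∧-conicalʳ (H x y) _ e
    rewrite dec-true (x ≟ a) x≡a | dec-true (y ≟ b) y≡b with () ← e'

  removeEdge-kept : ∀ {x y} → H x y ≡ true → ¬ (x ≡ a × y ≡ b) → ¬ (x ≡ b × y ≡ a) →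
                    removeEdge H a b x y ≡ true
  removeEdge-kept {x} {y} e ≢ab ≢ba rewrite e with x ≟ a | y ≟ b | x ≟ b | y ≟ a
  ... | yes x≡a | yes y≡b | _       | _       = contradiction (x≡a , y≡b) ≢ab
  ... | _       | _       | yes x≡b | yes y≡a = contradiction (x≡b , y≡a) ≢ba
  ... | yes _   | no _    | yes _   | no _    = refl
  ... | yes _   | no _    | no _    | _       = refl
  ... | no _    | _       | yes _   | no _    = refl
  ... | no _    | _       | no _    | _       = refl

  removeEdge-symmetric : Symmetric H → Symmetric (removeEdge H a b)
  removeEdge-symmetric symmetric x y = cong₂ _∧_ (symmetric x y) (cong not (trans
    (∨-comm (does (x ≟ a) ∧ does (y ≟ b)) _)
    (cong₂ _∨_ (∧-comm (does (x ≟ b)) _) (∧-comm (does (x ≟ a)) _))))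

-- Rooted trees

module _ {n : ℕ} (parent : Fin n → Fin n) where

  -- Once the root is its own parent, climbing beyond it stays there, so `i` may exceed the depth of
  -- `v`.
  up : ℕ → Fin n → Fin n
  up zero    v = v
  up (suc i) v = up i (parent v)

  Ancestor : Fin n → Fin n → Set
  Ancestor a v = ∃ λ i → up i v ≡ a

  up-suc : ∀ i v → up (suc i) v ≡ parent (up i v)
  up-suc zero    v = refl
  up-suc (suc i) v = up-suc i (parent v)

  up-+ : ∀ i j v → up (i + j) v ≡ up j (up i v)
  up-+ zero    j v = refl
  up-+ (suc i) j v = up-+ i j (parent v)

  up-ancestor : ∀ {i j} → i ≤ j → ∀ v → Ancestor (up j v) (up i v)
  up-ancestor {i} {j} i≤j v = j ∸ i , trans (sym (up-+ i (j ∸ i) v)) (cong (λ k → up k v) (m+[n∸m]≡n i≤j))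

  ancestor-trans : ∀ {a b c} → Ancestor a b → Ancestor b c → Ancestor a c
  ancestor-trans {c = c} (i , refl) (j , refl) = j + i , up-+ j i c

  ancestor-parent : ∀ {a v} → Ancestor a v → v ≢ a → Ancestor a (parent v)
  ancestor-parent (zero  , v≡a) v≢a = contradiction v≡a v≢a
  ancestor-parent (suc i , e)   v≢a = i , e

  ancestor-of-parent : ∀ {a v} → Ancestor a (parent v) → Ancestor a v
  ancestor-of-parent (i , e) = suc i , e

module RootedTree {n : ℕ} {G : EdgeSet n} {r : Fin n} {parent : Fin n → Fin n}
                  (simple : IsSimpleGraph G) (tree : IsRootedSpanningTree G r parent) where

  open IsSimpleGraph simple public
  open IsRootedSpanningTree tree public

  Child : Fin n → Fin n → Set
  Child c v = c ≢ r × parent c ≡ v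

  up-root : ∀ i → up parent i r ≡ r
  up-root zero    = refl
  up-root (suc i) = trans (cong (up parent i) parent-root) (up-root i)

  up-root-≤ : ∀ {i j v} → up parent i v ≡ r → i ≤ j → up parent j v ≡ r
  up-root-≤ {v = v} e i≤j with up-ancestor parent i≤j v
  ... | k , e' = trans (sym e') (trans (cong (up parent k) e) (up-root k))

  up-depth : ∀ {v d} → Depth parent r v d → up parent d v ≡ r
  up-depth root       = refl
  up-depth (step _ p) = up-depth p

  depth-unique : ∀ {v d e} → Depth parent r v d → Depth parent r v e → d ≡ e
  depth-unique root         root         = refl
  depth-unique root         (step r≢r _) = contradiction refl r≢r
  depth-unique (step r≢r _) root         = contradiction refl r≢r
  depth-unique (step _ p)   (step _ q)   = cong suc (depth-unique p q)

  ancestor-depth-≤ : ∀ {a v d e} → Ancestor parent a v → Depth parent r a e → Depth parent r v d → e ≤ d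
  ancestor-depth-≤ (zero  , refl) p q          = ≤-reflexive (depth-unique p q)
  ancestor-depth-≤ (suc i , e)    p root       =
    ≤-reflexive (depth-unique p (subst (λ a → Depth parent r a 0) (trans (sym (up-root (suc i))) e) root))
  ancestor-depth-≤ (suc i , e)    p (step _ q) = m≤n⇒m≤1+n (ancestor-depth-≤ (i , e) p q)

  not-ancestor-of-parent : ∀ {v} → v ≢ r → ¬ Ancestor parent v (parent v)
  not-ancestor-of-parent {v} v≢r anc with reaches-root (parent v)
  ... | d , p = <-irrefl refl (ancestor-depth-≤ anc (step v≢r p) p)

  up-depth-∸ : ∀ {i v d} → i ≤ d → Depth parent r v d → Depth parent r (up parent i v) (d ∸ i)
  up-depth-∸ {zero}  _         p          = p
  up-depth-∸ {suc i} (s≤s i≤d) (step _ p) = up-depth-∸ i≤d p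

  -- The ancestors at distances 0 to `d` have distinct depths, hence are `suc d` distinct vertices.
  depth-< : ∀ {v d} → Depth parent r v d → d < n
  depth-< {v} {d} p = injective⇒≤ {f = λ i → up parent (toℕ i) v} λ {i} {j} e →
    toℕ-injective (∸-cancelˡ-≡ (toℕ≤pred[n] i) (toℕ≤pred[n] j)
      (depth-unique (up-depth-∸ (toℕ≤pred[n] i) p)
                    (subst (λ u → Depth parent r u (d ∸ toℕ j)) (sym e) (up-depth-∸ (toℕ≤pred[n] j) p))))

  ancestor? : ∀ a v → Dec (Ancestor parent a v)
  ancestor? a v = go (proj₂ (reaches-root v))
    where
    go : ∀ {v d} → Depth parent r v d → Dec (Ancestor parent a v)
    go root with r ≟ a
    ... | yes r≡a = yes (0 , r≡a)
    ... | no r≢a  = no λ (i , e) → r≢a (trans (sym (up-root i)) e)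
    go {v} (step _ p) with v ≟ a
    ... | yes v≡a = yes (0 , v≡a)
    ... | no v≢a with go p
    ... | yes anc = yes (ancestor-of-parent parent anc)
    ... | no ¬anc = no λ anc → ¬anc (ancestor-parent parent anc v≢a)

  root-ancestor : ∀ v → Ancestor parent r v
  root-ancestor v with reaches-root v
  ... | d , p = d , up-depth p

  parent-≢ : ∀ {v} → v ≢ r → parent v ≢ v
  parent-≢ {v} v≢r e
    with () ← trans (sym (parent-edge v v≢r)) (trans (cong (G v) e) (irreflexive v))

  adjacent-≢ : ∀ {v w} → G v w ≡ true → v ≢ w
  adjacent-≢ {v} Gvw refl with () ← trans (sym Gvw) (irreflexive v)

  child-adjacent : ∀ {c v} → Child c v → G v c ≡ true
  child-adjacent {c} (c≢r , refl) = trans (symmetric _ _) (parent-edge c c≢r)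

  adjacent-child : ∀ {c v} → G v c ≡ true → parent c ≡ v → Child c v
  adjacent-child Gvc refl = (λ { refl → adjacent-≢ Gvc parent-root }) , refl

  tree-symmetric : Symmetric (treeEdges r parent)
  tree-symmetric u v = ∨-comm (not (does (u ≟ r)) ∧ does (parent u ≟ v)) _

  tree-parent : ∀ {v} → v ≢ r → treeEdges r parent v (parent v) ≡ true
  tree-parent {v} v≢r rewrite dec-false (v ≟ r) v≢r | dec-true (parent v ≟ parent v) refl = refl

  tree-edge⁻ : ∀ {u v} → treeEdges r parent u v ≡ true → parent u ≡ v ⊎ parent v ≡ u
  tree-edge⁻ {u} {v} e with parent u ≟ v | parent v ≟ u
  ... | yes p | _     = inj₁ p
  ... | no _  | yes q = inj₂ q
  ... | no _  | no _
    with () ← subst₂ (λ x y → x ∨ y ≡ true) (∧-zeroʳ (not (does (u ≟ r)))) (∧-zeroʳ (not (does (v ≟ r)))) e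

  -- Covered tree edges and two-edge-connectivity

  record Covers (v x y : Fin n) : Set where
    constructor mkCovers
    field
      below    : Ancestor parent v x
      above    : ¬ Ancestor parent v y
      non-tree : y ≢ parent x

    -- A child of `x` would lie below `v` together with `x`, whereas `y` does not.
    non-tree' : parent y ≢ x
    non-tree' e = above (ancestor-of-parent parent (subst (Ancestor parent v) (sym e) below))

  -- A path from `v` to its parent that avoids their common edge must leave the subtree of `v`. It
  -- does not leave along a parent edge: for `x ≢ v` the parent of `x` is still in the subtree, and
  -- for `x ≡ v` that edge was removed.
  cut-crossed : ∀ {H} → TwoEdgeConnected H → ∀ {v} → v ≢ r → H v (parent v) ≡ true →
                ∃₂ λ x y → H x y ≡ true × Covers v x y
  cut-crossed {H} (_ , robust) {v} v≢r e
    with reach-exit (ancestor? v) (robust v (parent v) e v (parent v)) (0 , refl) (not-ancestor-of-parent v≢r)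
  ... | x , y , e' , below , above = x , y , removeEdge-⊆ H v (parent v) e' , mkCovers below above non-tree
    where
    non-tree : y ≢ parent x
    non-tree y≡px = above (subst (Ancestor parent v) (sym y≡px) (ancestor-parent parent below
      (λ x≡v → removeEdge-removed H v (parent v) e' (x≡v , trans y≡px (cong parent x≡v)))))

  augmentation-crossed : ∀ {A} → FeasibleAug G r parent A → ∀ {v} → v ≢ r →
                         ∃₂ λ x y → A x y ≡ true × Covers v x y
  augmentation-crossed {A} (_ , _ , tec) {v} v≢r
    with cut-crossed tec v≢r (cong (_∨ A v (parent v)) (tree-parent v≢r))
  ... | x , y , e , cov with treeEdges r parent x y in tree-xy
  ... | false = x , y , e , cov
  ... | true with tree-edge⁻ tree-xy
  ... | inj₁ p = contradiction (sym p) (Covers.non-tree cov)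
  ... | inj₂ q = contradiction q (Covers.non-tree' cov)

  module _ {A : EdgeSet n} (A-symmetric : Symmetric A)
           (A-covers : ∀ {v} → v ≢ r → ∃₂ λ x y → A x y ≡ true × Covers v x y) where

    private
      H : EdgeSet n
      H = treeEdges r parent ∪E A

      H-symmetric : Symmetric H
      H-symmetric u v = cong₂ _∨_ (tree-symmetric u v) (A-symmetric u v)

      H-parent : ∀ {v} → v ≢ r → H v (parent v) ≡ true
      H-parent {v} v≢r = cong (_∨ A v (parent v)) (tree-parent v≢r)

      H-added : ∀ {x y} → A x y ≡ true → H x y ≡ true
      H-added {x} {y} e = trans (cong (treeEdges r parent x y ∨_) e) (∨-zeroʳ _)

    connected-from-parents : ∀ {K} → Symmetric K → (∀ {v} → v ≢ r → Reach K v (parent v)) → Connected K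
    connected-from-parents {K} K-symmetric climb u v =
      reach-trans (to-root (proj₂ (reaches-root u))) (reach-sym K-symmetric (to-root (proj₂ (reaches-root v))))
      where
      to-root : ∀ {v d} → Depth parent r v d → Reach K v r
      to-root root         = here
      to-root (step v≢r p) = reach-trans (climb v≢r) (to-root p)

    -- Without the edge from c to its parent, the subtree of c and its complement remain
    -- connected, and the covering edge joins them.
    detour : ∀ {K} → Symmetric K → ∀ {c} → c ≢ r →
             (∀ {x y} → H x y ≡ true → ¬ (x ≡ c × y ≡ parent c) → ¬ (x ≡ parent c × y ≡ c) → K x y ≡ true) →
             Reach K c (parent c)
    detour {K} K-symmetric {c} c≢r kept with A-covers c≢r
    ... | x , y , Axy , cov =
      reach-trans (reach-sym K-symmetric (inside (proj₁ (Covers.below cov)) (proj₂ (Covers.below cov))))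
        (there crossing (reach-trans (outside (Covers.above cov) (proj₂ (reaches-root y)))
          (reach-sym K-symmetric (outside (not-ancestor-of-parent c≢r) (proj₂ (reaches-root (parent c)))))))
      where
      crossing : K x y ≡ true
      crossing = kept (H-added Axy) (λ { (refl , e) → Covers.non-tree cov e })
                                    (λ { (refl , refl) → Covers.non-tree' cov refl })

      outside : ∀ {u d} → ¬ Ancestor parent c u → Depth parent r u d → Reach K u r
      outside ¬anc root             = here
      outside ¬anc (step {u} u≢r p) = there
        (kept (H-parent u≢r) (λ (u≡c , _) → ¬anc (0 , u≡c)) (λ (_ , e) → ¬anc (1 , e)))
        (outside (λ anc → ¬anc (ancestor-of-parent parent anc)) p)

      inside : ∀ i {u} → up parent i u ≡ c → Reach K u c
      inside zero    refl  = here
      inside (suc i) {u} e with u ≟ c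
      ... | yes refl = here
      ... | no u≢c   = there
        (kept (H-parent λ { refl → c≢r (trans (sym e) (up-root (suc i))) }) (λ (u≡c , _) → u≢c u≡c)
              (λ { (refl , e') → not-ancestor-of-parent c≢r (1 , e') }))
        (inside i e)

    -- After any removal it suffices that each vertex still reaches its parent: this step is either
    -- intact or is the removed edge in one of its two orientations, where `detour` replaces it.
    covering-two-edge-connected : TwoEdgeConnected H
    covering-two-edge-connected =
      connected-from-parents H-symmetric (λ v≢r → there (H-parent v≢r) here) , robust
      where
      robust : ∀ a b → H a b ≡ true → Connected (removeEdge H a b)
      robust a b _ = connected-from-parents K-symmetric climb
        where
        K = removeEdge H a b

        K-symmetric : Symmetric K
        K-symmetric = removeEdge-symmetric H a b H-symmetric

        climb : ∀ {v} → v ≢ r → Reach K v (parent v)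
        climb {v} v≢r with v ≟ a ×-dec parent v ≟ b | v ≟ b ×-dec parent v ≟ a
        ... | yes (refl , refl) | _                 = detour K-symmetric v≢r (removeEdge-kept H _ _)
        ... | no _              | yes (refl , refl) =
          detour K-symmetric v≢r (λ e ≢₁ ≢₂ → removeEdge-kept H _ _ e ≢₂ ≢₁)
        ... | no ≢ab            | no ≢ba            = there (removeEdge-kept H a b (H-parent v≢r) ≢ab ≢ba) here

-- The greedy choice of links

  <-pred⇒suc-< : ∀ {i m} → i < pred m → suc i < m
  <-pred⇒suc-< {m = suc m} i<m = s≤s i<m

  -- The last conjunct tells a chosen link from a token handed on, since a token is only handed on
  -- to a child.
  Selected : (Fin n → ℕ) → (Fin n → Bool) → Fin n → Fin n → Set
  Selected target token x w = token x ≡ true × target x ≡ toℕ w × parent w ≢ x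

  -- best v and cover v count the edges above v that a link from the subtree of v, respectively a
  -- link chosen in that subtree, can cover; inherited v is the value of cover v before v itself
  -- chooses, so that v ≢ r is critical (forced to choose) when it is zero. A token at v requests
  -- the link that attains best v; target v is the end of that link if it leaves v, and otherwise
  -- the child to which the token is passed on.
  record Greedy : Set where
    field
      best cover inherited target : Fin n → ℕ
      token                       : Fin n → Bool
      best-link : ∀ {v w i} → G v w ≡ true → w ≢ parent v → parent w ≢ v →
                  ¬ Ancestor parent (up parent i v) w → i < best v
      best-child : ∀ {c v} → Child c v → pred (best c) ≤ best v
      best-attained : ∀ {v} → 0 < best v →
        (∃ λ c → Child c v × target v ≡ toℕ c × best v ≡ pred (best c)) ⊎
        (∃ λ w → G v w ≡ true × w ≢ parent v × parent w ≢ v × target v ≡ toℕ w ×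
                 (∀ {i} → i < best v → ¬ Ancestor parent (up parent i v) w))
      inherited-child : ∀ {c v} → Child c v → pred (cover c) ≤ inherited v
      inherited-attained : ∀ {v} → 0 < inherited v → ∃ λ c → Child c v × inherited v ≡ pred (cover c)
      cover-chosen : ∀ {v} → inherited v ≡ 0 → cover v ≡ best v
      cover-inherited : ∀ {v} → 0 < inherited v → cover v ≡ inherited v
      token-critical : ∀ {v} → v ≢ r → inherited v ≡ 0 → token v ≡ true
      token-passed : ∀ {c v} → Child c v → token v ≡ true → target v ≡ toℕ c → token c ≡ true
      token-origin : ∀ {v} → token v ≡ true →
        v ≢ r × (inherited v ≡ 0 ⊎ (token (parent v) ≡ true × target (parent v) ≡ toℕ v))

  -- The subtree of `v` has height less than the number given. This is the measure for recursions
  -- towards the leaves, as `Depth` only supports those towards the root.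
  Shallow : ℕ → Fin n → Set
  Shallow zero    v = ⊥
  Shallow (suc k) v = ∀ {c} → Child c v → Shallow k c

  shallow : ∀ {h} → (∀ v d → Depth parent r v d → d ≤ h) →
            ∀ k {v d} → Depth parent r v d → h < d + k → Shallow k v
  shallow {h} bound zero    {v} {d} p h<d   = <⇒≱ (subst (h <_) (+-identityʳ d) h<d) (bound v d p)
  shallow {h} bound (suc k) {d = d} p h<d+k (c≢r , refl) =
    shallow bound k (step c≢r p) (subst (h <_) (+-suc d k) h<d+k)

  -- Analysis of the greedy choice

  module _ (greedy : Greedy) where

    open Greedy greedy

    private
      Sel : Fin n → Fin n → Set
      Sel = Selected target token

    Critical : Fin n → Set
    Critical v = v ≢ r × inherited v ≡ 0

    -- The route of a token from its first argument along the targets, up to the link (x , w) where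
    -- it ends.
    data Choice : Fin n → Fin n → Fin n → Set where
      own  : ∀ {x w} → target x ≡ toℕ w → parent w ≢ x → Choice x x w
      pass : ∀ {c v x w} → Child c v → target v ≡ toℕ c → Choice c x w → Choice v x w

    -- The two constructors exclude each other: `pass` goes to a child, while the link of `own` does
    -- not lead to one.
    choice-functional : ∀ {v x x' w w'} → Choice v x w → Choice v x' w' → x ≡ x' × w ≡ w'
    choice-functional (own e _) (own e' _) = refl , toℕ-injective (trans (sym e) e')
    choice-functional (own e np) (pass (_ , p) e' _) =
      contradiction (trans (cong parent (toℕ-injective (trans (sym e) e'))) p) np
    choice-functional (pass (_ , p) e' _) (own e np) =
      contradiction (trans (cong parent (toℕ-injective (trans (sym e) e'))) p) np
    choice-functional (pass _ e q) (pass _ e' q') with toℕ-injective (trans (sym e) e')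
    ... | refl = choice-functional q q'

    -- Traces a token upwards to the critical vertex that issued it, extending the route by one
    -- `pass` per level; the trace ends in time because the root holds no token.
    selected-choice : ∀ {v x w d} → Depth parent r v d → token v ≡ true → Choice v x w →
                      ∃ λ c → Critical c × Choice c x w
    selected-choice p tv q with token-origin tv
    selected-choice p          tv q | v≢r , inj₁ inh≡0     = _ , (v≢r , inh≡0) , q
    selected-choice root       tv q | v≢r , inj₂ _         = contradiction refl v≢r
    selected-choice (step _ p) tv q | v≢r , inj₂ (tp , ta) = selected-choice p tp (pass (v≢r , refl) ta q)

    -- Follows the token down to the link. Each level adds one edge to the reach below, which is the
    -- `pred` in `best-attained`.
    best-realised : ∀ k {v} → Shallow k v → v ≢ r → 0 < best v → token v ≡ true →
      ∃₂ λ x w → Sel x w × G x w ≡ true × w ≢ parent x × Ancestor parent v x ×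
                 (∀ {i} → i < best v → ¬ Ancestor parent (up parent i v) w)
    best-realised (suc k) sh v≢r pos tv with best-attained pos
    ... | inj₂ (w , Gvw , w≢ , np , tgt , free) = _ , w , (tv , tgt , np) , Gvw , w≢ , (0 , refl) , free
    ... | inj₁ (c , child@(c≢r , refl) , tgt , e) with best-realised k (sh child) c≢r
                     (≤-trans (subst (0 <_) e pos) pred[n]≤n) (token-passed child tv tgt)
    ... | x , w , sel , Gxw , w≢ , anc , free =
      x , w , sel , Gxw , w≢ , ancestor-trans parent (1 , refl) anc ,
      -- The ancestor `i` steps above `v` is `suc i` steps above its child `c`.
      λ {i} i<b → free (<-pred⇒suc-< (subst (i <_) e i<b))

    -- Descends along the children from which the cover is inherited to a critical vertex, where
    -- cover and best coincide and a token is present.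
    cover-realised : ∀ k {v} → Shallow k v → v ≢ r → 0 < cover v →
      ∃₂ λ x w → Sel x w × G x w ≡ true × w ≢ parent x × Ancestor parent v x ×
                 (∀ {i} → i < cover v → ¬ Ancestor parent (up parent i v) w)
    cover-realised (suc k) {v} sh v≢r pos with inherited v in eq
    ... | zero rewrite cover-chosen eq = best-realised (suc k) sh v≢r pos (token-critical v≢r eq)
    ... | suc m with inherited-attained (subst (0 <_) (sym eq) (s≤s z≤n))
    ... | c , child@(c≢r , refl) , e with cover-realised k (sh child) c≢r
                     (≤-trans (subst (0 <_) (trans (sym eq) e) (s≤s z≤n)) pred[n]≤n)
    ... | x , w , sel , Gxw , w≢ , anc , free =
      x , w , sel , Gxw , w≢ , ancestor-trans parent (1 , refl) anc ,
      λ {i} i<b → free (<-pred⇒suc-< (subst (i <_) (trans (cover-inherited (subst (0 <_) (sym eq) (s≤s z≤n))) e) i<b))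

    -- Reach is counted from the current vertex, so each level climbed from `x` costs one unit,
    -- which is what `best-child` allows.
    link-best : ∀ j {x w i} → G x w ≡ true → w ≢ parent x → parent w ≢ x → up parent j x ≢ r →
                ¬ Ancestor parent (up parent (j + i) x) w → i < best (up parent j x)
    link-best zero    Gxw w≢ np _   free = best-link Gxw w≢ np free
    link-best (suc j) {x} {w} {i} Gxw w≢ np j≢r free =
      subst (λ v → i < best v) (sym (up-suc parent j x))
        (<-≤-trans (suc[m]≤n⇒m≤pred[n] (link-best j Gxw w≢ np j≢r'
                     (subst (λ k → ¬ Ancestor parent (up parent k x) w) (sym (+-suc j i)) free)))
                   (best-child (j≢r' , refl)))
      where
      j≢r' : up parent j x ≢ r
      j≢r' e = j≢r (up-root-≤ e (n≤1+n j))

    -- A cover loses at most one unit per level, and a positive inherited value is taken over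
    -- unchanged, so no vertex on the covered path chooses again.
    cover-inherited-above : ∀ i {v} → suc i < cover v → up parent i v ≢ r →
                            0 < inherited (up parent (suc i) v)
    cover-inherited-above zero    1<c v≢r =
      <-≤-trans (suc[m]≤n⇒m≤pred[n] 1<c) (inherited-child (v≢r , refl))
    cover-inherited-above (suc i) {v} i<c i≢r =
      cover-inherited-above i (subst (suc i <_) (sym (cover-inherited (≤-<-trans z≤n above))) above) i≢r
      where
      above : suc i < inherited (parent v)
      above = <-≤-trans (suc[m]≤n⇒m≤pred[n] i<c)
                        (inherited-child ((λ { refl → i≢r (up-root (suc i)) }) , refl))

    -- A critical vertex chooses a link reaching at least as high as (x , w), so no vertex above
    -- it on the path covered by (x , w) is critical.
    critical-unique-< : ∀ {j j' x w} → j < j' → Critical (up parent j x) → Critical (up parent j' x) →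
                        G x w ≡ true → ¬ Covers (up parent j' x) x w
    critical-unique-< {j} {x = x} {w} j<j' (j≢r , inh) (j'≢r , inh') Gxw cov with m≤n⇒∃[o]m+o≡n j<j'
    ... | i , refl = >⇒≢ (cover-inherited-above i
        (subst (suc i <_) (sym (cover-chosen inh))
          (link-best j Gxw (Covers.non-tree cov) (Covers.non-tree' cov) j≢r
            (subst (λ k → ¬ Ancestor parent (up parent k x) w) (sym (+-suc j i)) (Covers.above cov))))
        (λ e → j'≢r (trans up-split (trans (up-suc parent i _) (trans (cong parent e) parent-root)))))
      (trans (sym (cong inherited up-split)) inh')
      where
      up-split : up parent (suc j + i) x ≡ up parent (suc i) (up parent j x)
      up-split = trans (cong (λ k → up parent k x) (sym (+-suc j i))) (up-+ parent j (suc i) x)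

    -- Both vertices are ancestors of `x`, so they are equal or one lies above the other.
    critical-unique : ∀ {v v' x w} → Critical v → Critical v' → G x w ≡ true →
                      Covers v x w → Covers v' x w → v ≡ v'
    critical-unique cv cv' Gxw cov@(mkCovers (j , refl) _ _) cov'@(mkCovers (j' , refl) _ _)
      with <-cmp j j'
    ... | tri< j<j' _ _ = contradiction cov' (critical-unique-< j<j' cv cv' Gxw)
    ... | tri≈ _ refl _ = refl
    ... | tri> _ _ j'<j = contradiction cov (critical-unique-< j'<j cv' cv Gxw)

    -- Two-edge-connectivity of `G` provides a non-tree edge out of the subtree of `v`, so a
    -- critical vertex always has a link to choose.
    best-positive : TwoEdgeConnected G → ∀ {v} → v ≢ r → 0 < best v
    best-positive tec {v} v≢r with cut-crossed tec v≢r (parent-edge v v≢r)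
    ... | x , w , Gxw , cov@(mkCovers (j , refl) _ _) =
      link-best j Gxw (Covers.non-tree cov) (Covers.non-tree' cov) v≢r
        (subst (λ k → ¬ Ancestor parent (up parent k x) w) (sym (+-identityʳ j)) (Covers.above cov))

    -- Feasibility holds because every cover is positive and realised by a selected link. For the
    -- size, the edges of `A` are charged injectively to the links of any other augmentation.
    selected-two-approx : TwoEdgeConnected G → ∀ {h} → (∀ v d → Depth parent r v d → d ≤ h) → ∀ {A} → Symmetric A →
                          (∀ {u v} → A u v ≡ true → G u v ≡ true × (Sel u v ⊎ Sel v u)) →
                          (∀ {u v} → G u v ≡ true → Sel u v → A u v ≡ true) →
                          TwoApprox G r parent A
    selected-two-approx tec {h} bound {A} A-symmetric A⇒Sel Sel⇒A =
      (A-symmetric , (λ u v → proj₁ ∘ A⇒Sel) , covering-two-edge-connected A-symmetric covers) , optimal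
      where
      cover-positive : ∀ {v} → v ≢ r → 0 < cover v
      cover-positive {v} v≢r with inherited v in eq
      ... | zero  = subst (0 <_) (sym (cover-chosen eq)) (best-positive tec v≢r)
      ... | suc _ = subst (0 <_) (sym (cover-inherited inh>0)) inh>0
        where inh>0 = subst (0 <_) (sym eq) (s≤s z≤n)

      covers : ∀ {v} → v ≢ r → ∃₂ λ x y → A x y ≡ true × Covers v x y
      covers {v} v≢r
        with cover-realised (suc h) (shallow bound (suc h) (proj₂ (reaches-root v)) (m≤n+m (suc h) _)) v≢r
               (cover-positive v≢r)
      ... | x , w , sel , Gxw , w≢ , anc , free =
        x , w , Sel⇒A Gxw sel , mkCovers anc (free (cover-positive v≢r)) w≢

      -- The critical vertex `c` issued the token that ended at the edge {u , v}, and (x , w) covers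
      -- the tree edge above `c`. The link determines `c` by `critical-unique`, and `c` determines
      -- the edge by `choice-functional`.
      Charged : Fin n × Fin n → Fin n × Fin n → Set
      Charged (u , v) (x , w) = toℕ u < toℕ v × G x w ≡ true ×
        ∃ λ c → Critical c × (Choice c u v ⊎ Choice c v u) × Covers c x w

      charged-injective : ∀ {p p' q} → Charged p q → Charged p' q → p ≡ p'
      charged-injective (u<v , Gxw , c , crit , ch , cov) (u'<v' , _ , c' , crit' , ch' , cov')
        with critical-unique crit crit' Gxw cov cov'
      ... | refl with ch | ch'
      ... | inj₁ q | inj₁ q' = cong₂ _,_ (proj₁ (choice-functional q q')) (proj₂ (choice-functional q q'))
      ... | inj₂ q | inj₂ q' = cong₂ _,_ (proj₂ (choice-functional q q')) (proj₁ (choice-functional q q'))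
      ... | inj₁ q | inj₂ q' with choice-functional q q'
      -- The same pair in opposite orientations cannot be increasing in both.
      ...   | refl , refl = contradiction u'<v' (<-asym u<v)
      charged-injective (u<v , Gxw , c , crit , ch , cov) (u'<v' , _ , c' , crit' , ch' , cov')
        | refl | inj₂ q | inj₁ q' with choice-functional q q'
      ...   | refl , refl = contradiction u'<v' (<-asym u<v)

      optimal : ∀ A' → FeasibleAug G r parent A' → edgeCount A ≤ 2 * edgeCount A'
      optimal A' feasible@(A'-symmetric , A'⊆G , _) = subst (edgeCount A ≤_) (length-orientedEdges A')
        (length-≤ Charged (edgeList-unique A) _ charge charged-injective)
        where
        selected-critical : ∀ {x w} → Sel x w → ∃ λ c → Critical c × Choice c x w
        selected-critical {x} (tx , tgt , np) =
          selected-choice (proj₂ (reaches-root x)) tx (own tgt np)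

        critical-choice : ∀ {u v} → Sel u v ⊎ Sel v u →
                          ∃ λ c → Critical c × (Choice c u v ⊎ Choice c v u)
        critical-choice (inj₁ sel) with selected-critical sel
        ... | c , crit , ch = c , crit , inj₁ ch
        critical-choice (inj₂ sel) with selected-critical sel
        ... | c , crit , ch = c , crit , inj₂ ch

        charge : ∀ {p} → p ∈ edgeList A → ∃ λ q → q ∈ edgeList A' ++ map swap (edgeList A') × Charged p q
        charge p∈ with ∈-edgeList⁻ A p∈
        ... | u<v , Auv with critical-choice (proj₂ (A⇒Sel Auv))
        ... | c , crit , ch with augmentation-crossed feasible (proj₁ crit)
        ... | x , w , A'xw , cov =
          (x , w) , ∈-orientedEdges A' A'-symmetric (adjacent-≢ (A'⊆G x w A'xw)) A'xw ,
          u<v , A'⊆G x w A'xw , c , crit , ch , cov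

-- Messages

width : ℕ → ℕ
width n = ⌊log₂ n ⌋ + 1

<-2^width : ∀ n → n < 2 ^ width n
<-2^width n = ≰⇒> λ 2^w≤n → <-irrefl refl (begin-strict
  ⌊log₂ n ⌋             <⟨ n<1+n _ ⟩
  suc ⌊log₂ n ⌋         ≡⟨ +-comm 1 _ ⟩
  width n               ≡⟨ ⌊log₂[2^n]⌋≡n (width n) ⟨
  ⌊log₂ 2 ^ width n ⌋   ≤⟨ ⌊log₂⌋-mono-≤ 2^w≤n ⟩
  ⌊log₂ n ⌋             ∎)
  where open ≤-Reasoning

-- Fixed-width binary, least significant bit first, put in front of the remaining bits so that
-- fields need no separators.
writeBits : ℕ → ℕ → List Bool → List Bool
writeBits zero    x bs = bs
writeBits (suc w) x bs = does (x % 2 ℕ.≟ 1) ∷ writeBits w (x / 2) bs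

readBits : ℕ → List Bool → ℕ × List Bool
readBits zero    bs       = 0 , bs
readBits (suc w) []       = 0 , []
readBits (suc w) (b ∷ bs) =
  (if b then 1 else 0) + proj₁ (readBits w bs) * 2 , proj₂ (readBits w bs)

readBits-writeBits : ∀ w {x} bs → x < 2 ^ w → readBits w (writeBits w x bs) ≡ (x , bs)
readBits-writeBits zero    {zero}  bs _ = refl
readBits-writeBits zero    {suc x} bs (s≤s ())
readBits-writeBits (suc w) {x} bs x<2^w
  rewrite readBits-writeBits w {x / 2} bs (m<n*o⇒m/o<n (subst (x <_) (*-comm 2 (2 ^ w)) x<2^w)) =
  cong (_, bs) (trans (cong (_+ (x / 2) * 2) (bit (m%n<n x 2))) (sym (m≡m%n+[m/n]*n x 2)))
  where
  bit : ∀ {b} → b < 2 → (if does (b ℕ.≟ 1) then 1 else 0) ≡ b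
  bit {zero}        _ = refl
  bit {suc zero}    _ = refl
  bit {suc (suc b)} (s≤s (s≤s ()))

length-writeBits : ∀ w x bs → length (writeBits w x bs) ≡ w + length bs
length-writeBits zero    x bs = refl
length-writeBits (suc w) x bs = cong suc (length-writeBits w (x / 2) bs)

-- The content of a message: stream is the ancestor at distance t in round t; deep tells whether
-- there is a descendant at distance t; done tells that the sender knows that t exceeds the height.
record Report : Set where
  no-eta-equality
  pattern
  constructor mkReport
  field
    name stream reach coverage aim : ℕ
    deep done token                : Bool

open Report

silence : Report
silence = record { name = 0 ; stream = 0 ; reach = 0 ; coverage = 0 ; aim = 0
                 ; deep = false ; done = false ; token = false }

encode : ℕ → Report → Message
encode w m = writeBits w (name m) (writeBits w (stream m) (writeBits w (reach m)
  (writeBits w (coverage m) (writeBits w (aim m) (deep m ∷ done m ∷ token m ∷ [])))))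

decode : ℕ → Message → Report
decode w bs₀ =
  let name     , bs₁ = readBits w bs₀
      stream   , bs₂ = readBits w bs₁
      reach    , bs₃ = readBits w bs₂
      coverage , bs₄ = readBits w bs₃
      aim      , bs₅ = readBits w bs₄
      deep , done , token = flags bs₅
  in mkReport name stream reach coverage aim deep done token
  where
  flags : List Bool → Bool × Bool × Bool
  flags (x ∷ y ∷ z ∷ _) = x , y , z
  flags _               = false , false , false

record Bounded (n : ℕ) (m : Report) : Set where
  field
    name≤     : name m ≤ n
    stream≤   : stream m ≤ n
    reach≤    : reach m ≤ n
    coverage≤ : coverage m ≤ n
    aim≤      : aim m ≤ n

decode-encode : ∀ {n m} w → n < 2 ^ w → Bounded n m → decode w (encode w m) ≡ m
decode-encode {n} {m@(mkReport _ _ _ _ _ _ _ _)} w n<2^w b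
  rewrite readBits-writeBits w {name m} (writeBits w (stream m) (writeBits w (reach m)
            (writeBits w (coverage m) (writeBits w (aim m) (deep m ∷ done m ∷ token m ∷ [])))))
            (≤-<-trans (Bounded.name≤ b) n<2^w)
        | readBits-writeBits w {stream m} (writeBits w (reach m)
            (writeBits w (coverage m) (writeBits w (aim m) (deep m ∷ done m ∷ token m ∷ []))))
            (≤-<-trans (Bounded.stream≤ b) n<2^w)
        | readBits-writeBits w {reach m}
            (writeBits w (coverage m) (writeBits w (aim m) (deep m ∷ done m ∷ token m ∷ [])))
            (≤-<-trans (Bounded.reach≤ b) n<2^w)
        | readBits-writeBits w {coverage m} (writeBits w (aim m) (deep m ∷ done m ∷ token m ∷ []))
            (≤-<-trans (Bounded.coverage≤ b) n<2^w)
        | readBits-writeBits w {aim m} (deep m ∷ done m ∷ token m ∷ [])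
            (≤-<-trans (Bounded.aim≤ b) n<2^w) = refl

-- Five numbers of `width n` bits and three flags; as `width n` is at least 1, each flag is paid for
-- by one more `width n`.
length-encode : ∀ n m → length (encode (width n) m) ≤ 8 * width n
length-encode n m = begin
  length (encode w m)         ≡⟨ trans (field-length (name m) _) (cong (w +_)
                                 (trans (field-length (stream m) _) (cong (w +_)
                                 (trans (field-length (reach m) _) (cong (w +_)
                                 (trans (field-length (coverage m) _) (cong (w +_)
                                 (field-length (aim m) _)))))))) ⟩
  w + (w + (w + (w + (w + 3)))) ≤⟨ +-monoʳ-≤ w (+-monoʳ-≤ w (+-monoʳ-≤ w (+-monoʳ-≤ w (+-monoʳ-≤ w
                                     (*-monoʳ-≤ 3 (m≤n+m 1 ⌊log₂ n ⌋)))))) ⟩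
  8 * w                         ∎
  where
  open ≤-Reasoning
  w = width n
  field-length = length-writeBits w

-- Local computation

least : ℕ → (ℕ → Bool) → ℕ
least zero    p = 0
least (suc k) p = if p 0 then 0 else suc (least k (p ∘ suc))

least-≤ : ∀ k p → least k p ≤ k
least-≤ zero    p = z≤n
least-≤ (suc k) p with p 0
... | true  = z≤n
... | false = s≤s (least-≤ k (p ∘ suc))

-- The case `i ≡ k` is included: `least` never tests `p k`, but returns `k` when all smaller values
-- fail.
least-holds : ∀ {i} k p → i ≤ k → p i ≡ true → p (least k p) ≡ true × least k p ≤ i
least-holds {zero}  zero    p _         pi = pi , z≤n
least-holds {i}     (suc k) p i≤k       pi with p 0 in p0
... | true  = p0 , z≤n
least-holds {zero}  (suc k) p _         pi | false with () ← trans (sym p0) pi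
least-holds {suc i} (suc k) p (s≤s i≤k) pi | false with least-holds k (p ∘ suc) i≤k pi
... | holds , l≤i = holds , s≤s l≤i

least-minimal : ∀ {i} k p → i < least k p → p i ≡ false
least-minimal         (suc k) p i<l       with p 0 in p0
least-minimal {zero}  (suc k) p _         | false = p0
least-minimal {suc i} (suc k) p (s≤s i<l) | false = least-minimal k (p ∘ suc) i<l

-- Maximum and maximiser. The default (0 , 0) stands for the absence of a positive value, so only a
-- positive maximum is known to be attained.
optimum : (ℕ → ℕ) → List ℕ → ℕ × ℕ
optimum f []       = 0 , 0
optimum f (x ∷ xs) = if does (proj₁ (optimum f xs) <? f x) then (f x , x) else optimum f xs

optimum-≥ : ∀ f {x} xs → x ∈ xs → f x ≤ proj₁ (optimum f xs)
optimum-≥ f (y ∷ xs) x∈ with does (proj₁ (optimum f xs) <? f y) | proof (proj₁ (optimum f xs) <? f y)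
optimum-≥ f (y ∷ xs) (here refl) | true  | _       = ≤-refl
optimum-≥ f (y ∷ xs) (there x∈)  | true  | ofʸ o<f = ≤-trans (optimum-≥ f xs x∈) (<⇒≤ o<f)
optimum-≥ f (y ∷ xs) (here refl) | false | ofⁿ o≮f = ≮⇒≥ o≮f
optimum-≥ f (y ∷ xs) (there x∈)  | false | _       = optimum-≥ f xs x∈

optimum-attained : ∀ f xs → 0 < proj₁ (optimum f xs) →
                   ∃ λ x → x ∈ xs × optimum f xs ≡ (f x , x)
optimum-attained f (y ∷ xs) pos with does (proj₁ (optimum f xs) <? f y)
... | true = y , here refl , refl
... | false with optimum-attained f xs pos
... | x , x∈ , e = x , there x∈ , e

optimum-bounded : ∀ {n} f xs → (∀ x → f x ≤ n) → (∀ {x} → x ∈ xs → x ≤ n) →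
                  proj₁ (optimum f xs) ≤ n × proj₂ (optimum f xs) ≤ n
optimum-bounded f []       f≤ xs≤ = z≤n , z≤n
optimum-bounded f (y ∷ xs) f≤ xs≤ with does (proj₁ (optimum f xs) <? f y)
... | true  = f≤ y , xs≤ (here refl)
... | false = optimum-bounded f xs f≤ (xs≤ ∘ there)

optimum-cong : ∀ {f g} xs → (∀ {x} → x ∈ xs → f x ≡ g x) → optimum f xs ≡ optimum g xs
optimum-cong []       f≗g = refl
optimum-cong (y ∷ xs) f≗g
  rewrite optimum-cong xs (f≗g ∘ there) | f≗g (here refl) = refl

-- Indexed by the round and by the identifier of the sender.
History : Set
History = ℕ → ℕ → Report

module View (i : LocalInput) (H : History) where

  open LocalInput i using (numVertices; myId; neighbours)

  neighbourIds : List ℕ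
  neighbourIds = map proj₁ neighbours

  -- The root is its own parent.
  parentName : ℕ
  parentName = fromMaybe myId (LocalInput.parentId i)

  isRoot : Bool
  isRoot = does (parentName ℕ.≟ myId)

  isChild : ℕ → ℕ → Bool
  isChild t w = does (name (H t w) ℕ.≟ myId)

  -- What the parent streams in round `s` is its ancestor at distance `s`, which is the own ancestor
  -- at distance `suc s`.
  chain : ℕ → ℕ
  chain zero    = myId
  chain (suc s) = if isRoot then myId else stream (H s parentName)

  -- Tests whether the own ancestor at distance `k` is an ancestor of `w`, as far as the names
  -- streamed by `w` up to round `t` show it.
  meets : ℕ → ℕ → ℕ → Bool
  meets t w k = any (λ j → does (stream (H j w) ℕ.≟ chain k)) (upTo (suc t))

  -- The number of edges above the own vertex that can be covered by way of `w`: one less than the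
  -- reach of a child, none through the parent, and for a non-tree edge the distance to the lowest
  -- common ancestor.
  gain : ℕ → ℕ → ℕ
  gain t w =
    if isChild t w then pred (reach (H t w)) else
    if does (w ℕ.≟ parentName) then 0 else least numVertices (meets t w)

  inheritance : ℕ → ℕ → ℕ
  inheritance t w = if isChild t w then pred (coverage (H t w)) else 0

  inherited : ℕ → ℕ
  inherited t = proj₁ (optimum (inheritance t) neighbourIds)

  deepAt : ℕ → Bool
  deepAt zero    = true
  deepAt (suc t) = any (λ w → isChild t w ∧ deep (H t w)) neighbourIds

  doneAt : ℕ → Bool
  doneAt zero    = false
  doneAt (suc t) = if isRoot then not (deepAt (suc t)) else done (H t parentName)

  report : ℕ → Report
  report zero    = record silence { name = parentName ; stream = myId ; deep = true }
  report (suc t) = record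
    { name     = parentName
    ; stream   = chain (suc t)
    ; reach    = proj₁ (optimum (gain t) neighbourIds)
    ; coverage = if does (inherited t ℕ.≟ 0) then proj₁ (optimum (gain t) neighbourIds) else inherited t
    ; aim      = proj₂ (optimum (gain t) neighbourIds)
    ; deep     = deepAt (suc t)
    ; done     = doneAt (suc t)
    ; token    = not isRoot ∧ (does (inherited t ℕ.≟ 0) ∨
                               (token (H t parentName) ∧ does (aim (H t parentName) ℕ.≟ myId)))
    }

  -- The two disjuncts are the two orientations of the edge. The own choice is read from round
  -- `suc t` and that of the neighbour from round `t`; the difference vanishes once the values are
  -- stable.
  chosen : ℕ → ℕ → Bool
  chosen t w =
    (token (report (suc t)) ∧ does (aim (report (suc t)) ℕ.≟ w) ∧ not (isChild t w)) ∨
    (token (H t w) ∧ does (aim (H t w) ℕ.≟ myId) ∧ not (does (parentName ℕ.≟ w)))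

  module _ (id≤ : myId ≤ numVertices) (parent≤ : parentName ≤ numVertices)
           (ids≤ : ∀ {w} → w ∈ neighbourIds → w ≤ numVertices)
           (H≤ : ∀ s w → Bounded numVertices (H s w)) where

    chain-bounded : ∀ s → chain s ≤ numVertices
    chain-bounded zero    = id≤
    chain-bounded (suc s) with isRoot
    ... | true  = id≤
    ... | false = Bounded.stream≤ (H≤ s parentName)

    gain-bounded : ∀ t w → gain t w ≤ numVertices
    gain-bounded t w with isChild t w | does (w ℕ.≟ parentName)
    ... | true  | _     = ≤⇒pred≤ (Bounded.reach≤ (H≤ t w))
    ... | false | true  = z≤n
    ... | false | false = least-≤ numVertices _

    inheritance-bounded : ∀ t w → inheritance t w ≤ numVertices
    inheritance-bounded t w with isChild t w
    ... | true  = ≤⇒pred≤ (Bounded.coverage≤ (H≤ t w))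
    ... | false = z≤n

    report-bounded : ∀ t → Bounded numVertices (report t)
    report-bounded zero = record
      { name≤ = parent≤ ; stream≤ = id≤ ; reach≤ = z≤n ; coverage≤ = z≤n ; aim≤ = z≤n }
    report-bounded (suc t) = record
      { name≤     = parent≤
      ; stream≤   = chain-bounded (suc t)
      ; reach≤    = proj₁ optimum≤
      ; coverage≤ = coverage-bounded
      ; aim≤      = proj₂ optimum≤
      }
      where
      optimum≤ = optimum-bounded (gain t) neighbourIds (gain-bounded t) ids≤

      coverage-bounded : coverage (report (suc t)) ≤ numVertices
      coverage-bounded with does (inherited t ℕ.≟ 0)
      ... | true  = proj₁ optimum≤
      ... | false = proj₁ (optimum-bounded (inheritance t) neighbourIds (inheritance-bounded t) ids≤)

-- The algorithm

lookupReport : ℕ → List (ℕ × Message) → ℕ → Report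
lookupReport w []               u = silence
lookupReport w ((s , bs) ∷ msgs) u = if does (s ℕ.≟ u) then decode w bs else lookupReport w msgs u

record State : Set where
  field
    input    : LocalInput
    time     : ℕ
    history  : History
    decision : Maybe (ℕ → Bool)

open State

-- A decision once taken is kept, which makes the output irrevocable.
decide : Maybe (ℕ → Bool) → Bool → (ℕ → Bool) → Maybe (ℕ → Bool)
decide (just o) _     _ = just o
decide nothing  true  o = just o
decide nothing  false _ = nothing

extend : History → ℕ → (ℕ → Report) → History
extend H t received s w = if does (s ℕ.≟ t) then received w else H s w

-- done at round s means that s exceeds the height, and after 4 s rounds all values are stable.
algorithm : Algorithm
algorithm = record
  { State  = State
  ; init   = λ i → record { input = i ; time = 0 ; history = λ _ _ → silence ; decision = nothing }
  ; send   = λ σ _ → encode (width (LocalInput.numVertices (input σ)))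
                            (View.report (input σ) (history σ) (time σ))
  ; update = λ σ msgs →
      let H = extend (history σ) (time σ)
                     (lookupReport (width (LocalInput.numVertices (input σ))) msgs)
          open View (input σ) H
      in record { input = input σ ; time = suc (time σ) ; history = H
                ; decision = decide (decision σ) (doneAt (suc (time σ) / 4)) (chosen (time σ)) }
  ; output = decision
  }

-- Boolean tests and local inputs

any-true⁻ : ∀ {A : Set} (p : A → Bool) xs → any p xs ≡ true → ∃ λ x → x ∈ xs × p x ≡ true
any-true⁻ p xs e with find (Any.any⁻ p xs (Equivalence.from T-≡ e))
... | x , x∈ , Tp = x , x∈ , Equivalence.to T-≡ Tp

any-true⁺ : ∀ {A : Set} (p : A → Bool) {x xs} → x ∈ xs → p x ≡ true → any p xs ≡ true
any-true⁺ p x∈ px = Equivalence.to T-≡ (Any.any⁺ p (lose x∈ (Equivalence.from T-≡ px)))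

any-cong : ∀ {A : Set} {p q : A → Bool} {xs} → (∀ {x} → x ∈ xs → p x ≡ q x) → any p xs ≡ any q xs
any-cong p≗q = cong or (map-cong-local (All.tabulate p≗q))

if-true : ∀ {A : Set} {b} {x y : A} → b ≡ true → (if b then x else y) ≡ x
if-true refl = refl

if-false : ∀ {A : Set} {b} {x y : A} → b ≡ false → (if b then x else y) ≡ y
if-false refl = refl

does-true : ∀ {P : Set} (P? : Dec P) → does P? ≡ true → P
does-true (yes p) _ = p

module LocalInputs {n : ℕ} {G : EdgeSet n} {r : Fin n} {parent : Fin n → Fin n}
                   (simple : IsSimpleGraph G) (tree : IsRootedSpanningTree G r parent) where

  open RootedTree simple tree

  local : Fin n → LocalInput
  local = localInput G r parent

  parentName-local : ∀ v {K} → View.parentName (local v) K ≡ toℕ (parent v)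
  parentName-local v with v ≟ r
  ... | yes refl = cong toℕ (sym parent-root)
  ... | no _     = refl

  neighbourIds-local : ∀ v {K} → View.neighbourIds (local v) K ≡ map toℕ (neighbourList G v)
  neighbourIds-local v = sym (map-∘ (neighbourList G v))

  adjacent-∈ : ∀ {v u K} → G v u ≡ true → toℕ u ∈ View.neighbourIds (local v) K
  adjacent-∈ {v} {u} {K} Gvu = subst (toℕ u ∈_) (sym (neighbourIds-local v {K}))
    (∈-map⁺ toℕ (∈-filter⁺ (λ u → G v u Bool.≟ true) (∈-allFin u) Gvu))

  ∈-adjacent : ∀ {v k K} → k ∈ View.neighbourIds (local v) K → ∃ λ u → G v u ≡ true × k ≡ toℕ u
  ∈-adjacent {v} {k} {K} k∈ with ∈-map⁻ toℕ (subst (k ∈_) (neighbourIds-local v {K}) k∈)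
  ... | u , u∈ , refl = u , proj₂ (∈-filter⁻ (λ u → G v u Bool.≟ true) {xs = allFin n} u∈) , refl

-- The synchronous dynamics

-- H t v is what v has heard before round t.
module Dynamics {n : ℕ} {G : EdgeSet n} {r : Fin n} {parent : Fin n → Fin n} {h : ℕ}
                (simple : IsSimpleGraph G) (tree : IsRootedSpanningTree G r parent)
                (height : IsHeight r parent h)
                (H : ℕ → Fin n → History)
                (heard : ∀ {t v s u} → s < t → G v u ≡ true →
                         H t v s (toℕ u) ≡ View.report (localInput G r parent u) (H s u) s) where

  open RootedTree simple tree
  open LocalInputs simple tree

  module V (t : ℕ) (v : Fin n) = View (local v) (H t v)

  X : ℕ → Fin n → Report
  X t v = V.report t v t

  heard-parent : ∀ {t v s} → s < t → v ≢ r → H t v s (V.parentName t v) ≡ X s (parent v)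
  heard-parent {t} {v} {s} s<t v≢r = trans (cong (H t v s) (parentName-local v {H t v}))
                                           (heard s<t (parent-edge v v≢r))

  name-X : ∀ t v → name (X t v) ≡ toℕ (parent v)
  name-X zero    v = parentName-local v {H 0 v}
  name-X (suc t) v = parentName-local v {H (suc t) v}

  isRoot-root : ∀ t → V.isRoot t r ≡ true
  isRoot-root t = dec-true (_ ℕ.≟ _) (trans (parentName-local r {H t r}) (cong toℕ parent-root))

  isRoot-other : ∀ t {v} → v ≢ r → V.isRoot t v ≡ false
  isRoot-other t {v} v≢r = dec-false (_ ℕ.≟ _) (λ e →
    parent-≢ v≢r (toℕ-injective (trans (sym (parentName-local v {H t v})) e)))

  isChild-true : ∀ {t v s u} → s < t → G v u ≡ true → parent u ≡ v → V.isChild t v s (toℕ u) ≡ true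
  isChild-true {s = s} {u} s<t Gvu pu≡v =
    dec-true (_ ℕ.≟ _) (trans (cong name (heard s<t Gvu)) (trans (name-X s u) (cong toℕ pu≡v)))

  isChild-false : ∀ {t v s u} → s < t → G v u ≡ true → parent u ≢ v → V.isChild t v s (toℕ u) ≡ false
  isChild-false {s = s} {u} s<t Gvu pu≢v =
    dec-false (_ ℕ.≟ _) (λ e → pu≢v (toℕ-injective
      (trans (sym (name-X s u)) (trans (sym (cong name (heard s<t Gvu))) e))))

  chain-up : ∀ s {t v} → s ≤ t → V.chain t v s ≡ toℕ (up parent s v)
  stream-X : ∀ t v → stream (X t v) ≡ toℕ (up parent t v)

  chain-up zero    s≤t = refl
  chain-up (suc s) {t} {v} s<t = split (v ≟ r)
    where
    split : Dec (v ≡ r) → V.chain t v (suc s) ≡ toℕ (up parent (suc s) v)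
    split (yes refl) = trans (if-true (isRoot-root t)) (cong toℕ (sym (up-root (suc s))))
    split (no v≢r)   = trans (if-false (isRoot-other t v≢r))
                             (trans (cong stream (heard-parent s<t v≢r)) (stream-X s (parent v)))

  stream-X zero    v = refl
  stream-X (suc t) v = chain-up (suc t) ≤-refl

  private
    bound : ∀ v d → Depth parent r v d → d ≤ h
    bound = proj₁ height

    h≤n : h ≤ n
    h≤n = <⇒≤ (depth-< (proj₂ (proj₂ height)))

  up-height : ∀ {i} v → h ≤ i → up parent i v ≡ r
  up-height v h≤i with reaches-root v
  ... | d , p = up-root-≤ (up-depth p) (≤-trans (bound v d p) h≤i)

  -- Lowest common ancestors from streamed names

  meets-ancestor : ∀ {t v w k} → G v w ≡ true → k ≤ suc t →
                   V.meets (suc t) v t (toℕ w) k ≡ true → Ancestor parent (up parent k v) w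
  meets-ancestor {t} {v} {w} {k} Gvw k≤1+t e with any-true⁻ _ (upTo (suc t)) e
  ... | j , j∈ , e' = j , toℕ-injective (begin
    toℕ (up parent j w)               ≡⟨ stream-X j w ⟨
    stream (X j w)                    ≡⟨ cong stream (heard (∈-upTo⁻ j∈) Gvw) ⟨
    stream (H (suc t) v j (toℕ w))    ≡⟨ does-true (_ ℕ.≟ _) e' ⟩
    V.chain (suc t) v k               ≡⟨ chain-up k k≤1+t ⟩
    toℕ (up parent k v)               ∎)
    where open ≡-Reasoning

  -- From `h` steps on, `up` only yields the root, so by round `t` the neighbour has streamed all
  -- its ancestors.
  recent-ancestor : ∀ {t a w} → h ≤ t → Ancestor parent a w → ∃ λ i → i ≤ t × up parent i w ≡ a
  recent-ancestor {t} {a} {w} h≤t (i , e) with i ≤? t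
  ... | yes i≤t = i , i≤t , e
  ... | no i≰t  = t , ≤-refl ,
    trans (up-height w h≤t) (trans (sym (up-height w (≤-trans h≤t (<⇒≤ (≰⇒> i≰t))))) e)

  ancestor-meets : ∀ {t v w k} → h ≤ t → G v w ≡ true → k ≤ suc t →
                   Ancestor parent (up parent k v) w → V.meets (suc t) v t (toℕ w) k ≡ true
  ancestor-meets {t} {v} {w} {k} h≤t Gvw k≤1+t anc with recent-ancestor h≤t anc
  ... | i , i≤t , e = any-true⁺ _ (∈-upTo⁺ (s≤s i≤t)) (dec-true (_ ℕ.≟ _) (begin
    stream (H (suc t) v i (toℕ w))    ≡⟨ cong stream (heard (s≤s i≤t) Gvw) ⟩
    stream (X i w)                    ≡⟨ stream-X i w ⟩
    toℕ (up parent i w)               ≡⟨ cong toℕ e ⟩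
    toℕ (up parent k v)               ≡⟨ chain-up k k≤1+t ⟨
    V.chain (suc t) v k               ∎))
    where open ≡-Reasoning

  -- The lowest common ancestor of `v` and `w` is `k` steps above `v`.
  Reaches : Fin n → Fin n → ℕ → Set
  Reaches v w k = Ancestor parent (up parent k v) w × (∀ {i} → i < k → ¬ Ancestor parent (up parent i v) w)

  reaches-unique : ∀ {v w k k'} → Reaches v w k → Reaches v w k' → k ≡ k'
  reaches-unique {k = k} {k'} (anc , min) (anc' , min') with <-cmp k k'
  ... | tri< k<k' _ _ = contradiction anc (min' k<k')
  ... | tri≈ _ e _    = e
  ... | tri> _ _ k'<k = contradiction anc' (min k'<k)

  -- The search succeeds within its limit `n` because the root is a common ancestor at most `h ≤ n`
  -- steps up.
  link-reaches : ∀ {t v w} → h ≤ t → G v w ≡ true →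
                 Reaches v w (least n (V.meets (suc t) v t (toℕ w)))
  link-reaches {t} {v} {w} h≤t Gvw =
    meets-ancestor Gvw (≤-trans (proj₂ holds) (m≤n⇒m≤1+n h≤t)) (proj₁ holds) , minimal
    where
    p : ℕ → Bool
    p = V.meets (suc t) v t (toℕ w)

    holds : p (least n p) ≡ true × least n p ≤ h
    holds = least-holds n p h≤n (ancestor-meets h≤t Gvw (m≤n⇒m≤1+n h≤t)
      (subst (λ a → Ancestor parent a w) (sym (up-height v ≤-refl)) (root-ancestor w)))

    minimal : ∀ {i} → i < least n p → ¬ Ancestor parent (up parent i v) w
    minimal i<l anc with () ← trans (sym (least-minimal n p i<l))
      (ancestor-meets h≤t Gvw (≤-trans (<⇒≤ (<-≤-trans i<l (proj₂ holds))) (m≤n⇒m≤1+n h≤t)) anc)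

  gain-child : ∀ {t v u} → G v u ≡ true → parent u ≡ v →
               V.gain (suc t) v t (toℕ u) ≡ pred (reach (X t u))
  gain-child Gvu pu≡v =
    trans (if-true (isChild-true ≤-refl Gvu pu≡v)) (cong (pred ∘ reach) (heard ≤-refl Gvu))

  gain-parent : ∀ {t v u} → G v u ≡ true → parent u ≢ v → u ≡ parent v →
                V.gain (suc t) v t (toℕ u) ≡ 0
  gain-parent {t} {v} Gvu pu≢v refl = trans (if-false (isChild-false ≤-refl Gvu pu≢v))
    (if-true (dec-true (_ ℕ.≟ _) (sym (parentName-local v {H (suc t) v}))))

  gain-link : ∀ {t v u} → G v u ≡ true → parent u ≢ v → u ≢ parent v →
              V.gain (suc t) v t (toℕ u) ≡ least n (V.meets (suc t) v t (toℕ u))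
  gain-link {t} {v} Gvu pu≢v u≢pv = trans (if-false (isChild-false ≤-refl Gvu pu≢v))
    (if-false (dec-false (_ ℕ.≟ _) (λ e → u≢pv (toℕ-injective (trans e (parentName-local v {H (suc t) v}))))))

  inheritance-child : ∀ {t v u} → G v u ≡ true → parent u ≡ v →
                      V.inheritance (suc t) v t (toℕ u) ≡ pred (coverage (X t u))
  inheritance-child Gvu pu≡v =
    trans (if-true (isChild-true ≤-refl Gvu pu≡v)) (cong (pred ∘ coverage) (heard ≤-refl Gvu))

  inheritance-other : ∀ {t v u} → G v u ≡ true → parent u ≢ v →
                      V.inheritance (suc t) v t (toℕ u) ≡ 0
  inheritance-other Gvu pu≢v = if-false (isChild-false ≤-refl Gvu pu≢v)

  -- Stabilisation

  record Stable (t : ℕ) (v : Fin n) : Set where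
    field
      reach-stable    : reach (X (suc t) v) ≡ reach (X t v)
      aim-stable      : aim (X (suc t) v) ≡ aim (X t v)
      coverage-stable : coverage (X (suc t) v) ≡ coverage (X t v)

  open Stable

  gain-stable : ∀ {t v u} → h ≤ t → G v u ≡ true → (Child u v → Stable t u) →
                V.gain (suc (suc t)) v (suc t) (toℕ u) ≡ V.gain (suc t) v t (toℕ u)
  gain-stable {t} {v} {u} h≤t Gvu stable with parent u ≟ v | u ≟ parent v
  ... | yes pu≡v | _        = trans (gain-child Gvu pu≡v)
    (trans (cong pred (reach-stable (stable (adjacent-child Gvu pu≡v)))) (sym (gain-child Gvu pu≡v)))
  ... | no pu≢v  | yes u≡pv = trans (gain-parent Gvu pu≢v u≡pv) (sym (gain-parent Gvu pu≢v u≡pv))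
  ... | no pu≢v  | no u≢pv  = trans (gain-link Gvu pu≢v u≢pv)
    (trans (reaches-unique (link-reaches (m≤n⇒m≤1+n h≤t) Gvu) (link-reaches h≤t Gvu))
           (sym (gain-link Gvu pu≢v u≢pv)))

  inheritance-stable : ∀ {t v u} → G v u ≡ true → (Child u v → Stable t u) →
                       V.inheritance (suc (suc t)) v (suc t) (toℕ u) ≡ V.inheritance (suc t) v t (toℕ u)
  inheritance-stable {t} {v} {u} Gvu stable with parent u ≟ v
  ... | yes pu≡v = trans (inheritance-child Gvu pu≡v)
    (trans (cong pred (coverage-stable (stable (adjacent-child Gvu pu≡v)))) (sym (inheritance-child Gvu pu≡v)))
  ... | no pu≢v  = trans (inheritance-other Gvu pu≢v) (sym (inheritance-other Gvu pu≢v))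

  optimum-stable : ∀ {f g : ℕ → ℕ} {v K} → (∀ {u} → G v u ≡ true → f (toℕ u) ≡ g (toℕ u)) →
                   optimum f (View.neighbourIds (local v) K) ≡ optimum g (View.neighbourIds (local v) K)
  optimum-stable {f} {g} {v} {K} f≗g = optimum-cong _ λ k∈ → at (∈-adjacent {K = K} k∈)
    where
    at : ∀ {k} → (∃ λ u → G v u ≡ true × k ≡ toℕ u) → f k ≡ g k
    at (u , Gvu , refl) = f≗g Gvu

  inherited-stable : ∀ {t v} → (∀ {u} → Child u v → Stable t u) →
                     V.inherited (suc (suc t)) v (suc t) ≡ V.inherited (suc t) v t
  inherited-stable {t} {v} stable = cong proj₁ (optimum-stable {v = v} {H t v} (λ Gvu → inheritance-stable {t} Gvu stable))

  -- The gains of non-tree edges are final from round `h`; the other values depend only on the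
  -- children and settle one level per round from the leaves upwards.
  shallow-stable : ∀ k {v t} → Shallow k v → h + k ≤ t → Stable t v
  shallow-stable (suc k) {v} {t} sh h+k≤t with t | subst (_≤ t) (+-suc h k) h+k≤t
  ... | suc t | s≤s h+k≤t' = record
    { reach-stable    = cong proj₁ gains
    ; aim-stable      = cong proj₂ gains
    ; coverage-stable = cong₂ (λ i b → if does (i ℕ.≟ 0) then b else i)
                              (inherited-stable {t} stable) (cong proj₁ gains)
    }
    where
    stable : ∀ {u} → Child u v → Stable t u
    stable child = shallow-stable k (sh child) h+k≤t'

    gains = optimum-stable {v = v} {H t v} (λ Gvu → gain-stable (m+n≤o⇒m≤o h h+k≤t') Gvu stable)

  settled : ℕ
  settled = h + suc h

  stable-from : ∀ {t} v → settled ≤ t → Stable t v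
  stable-from v = shallow-stable (suc h) (shallow bound (suc h) (proj₂ (reaches-root v)) (m≤n+m (suc h) _))

  token-root : ∀ t → token (X t r) ≡ false
  token-root zero    = refl
  token-root (suc t) rewrite isRoot-root (suc t) = refl

  token-other : ∀ {t v} → v ≢ r → token (X (suc t) v) ≡
                does (V.inherited (suc t) v t ℕ.≟ 0) ∨
                (token (X t (parent v)) ∧ does (aim (X t (parent v)) ℕ.≟ toℕ v))
  token-other {t} {v} v≢r =
    cong₂ (λ b m → not b ∧ (does (V.inherited (suc t) v t ℕ.≟ 0) ∨ (token m ∧ does (aim m ℕ.≟ toℕ v))))
          (isRoot-other (suc t) v≢r) (heard-parent ≤-refl v≢r)

  -- With aims and inherited values settled, tokens depend only on the parent and settle one level
  -- per round from the root downwards.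
  token-stable : ∀ {v d} t → Depth parent r v d → settled + suc d ≤ t → token (X (suc t) v) ≡ token (X t v)
  token-stable t root _ = trans (token-root (suc t)) (sym (token-root t))
  token-stable {d = suc d} t (step {v} v≢r p) le with t | subst (_≤ t) (+-suc settled (suc d)) le
  ... | suc t | s≤s le' = trans (token-other {suc t} v≢r) (trans
    (cong₂ _∨_ (cong (λ i → does (i ℕ.≟ 0)) (inherited-stable {t} (λ {u} _ → stable-from u settled≤t)))
      (cong₂ _∧_ (token-stable t p le')
                 (cong (λ a → does (a ℕ.≟ toℕ v)) (aim-stable (stable-from (parent v) settled≤t)))))
    (sym (token-other {t} v≢r)))
    where
    settled≤t : settled ≤ t
    settled≤t = m+n≤o⇒m≤o settled le'

  -- `h` rounds for the streamed names, then `suc h` for the upward and `suc h` for the downward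
  -- stabilisation.
  T : ℕ
  T = settled + suc h

  token-stable-from : ∀ {t} v → T ≤ t → token (X (suc t) v) ≡ token (X t v)
  token-stable-from {t} v T≤t with reaches-root v
  ... | d , p = token-stable t p (≤-trans (+-monoʳ-≤ settled (s≤s (bound v d p))) T≤t)

  aim-constant : ∀ {t} v → T ≤ t → aim (X t v) ≡ aim (X T v)
  aim-constant v T≤t with m≤n⇒∃[o]m+o≡n T≤t
  ... | k , refl = go k
    where
    go : ∀ k → aim (X (T + k) v) ≡ aim (X T v)
    go zero    = cong (λ t → aim (X t v)) (+-identityʳ T)
    go (suc k) = trans (cong (λ t → aim (X t v)) (+-suc T k))
      (trans (aim-stable (stable-from v (≤-trans (m≤m+n settled (suc h)) (m≤m+n T k)))) (go k))

  token-constant : ∀ {t} v → T ≤ t → token (X t v) ≡ token (X T v)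
  token-constant v T≤t with m≤n⇒∃[o]m+o≡n T≤t
  ... | k , refl = go k
    where
    go : ∀ k → token (X (T + k) v) ≡ token (X T v)
    go zero    = cong (λ t → token (X t v)) (+-identityʳ T)
    go (suc k) = trans (cong (λ t → token (X t v)) (+-suc T k))
      (trans (token-stable-from v (m≤m+n T k)) (go k))

  settled≤T : settled ≤ T
  settled≤T = m≤m+n settled (suc h)

  h≤T : h ≤ T
  h≤T = ≤-trans (m≤m+n h (suc h)) settled≤T

  -- The stable values as a greedy choice

  selectedBool : Fin n → Fin n → Bool
  selectedBool x w = token (X T x) ∧ does (aim (X T x) ℕ.≟ toℕ w) ∧ not (does (toℕ (parent w) ℕ.≟ toℕ x))

  -- The right-hand side is independent of `t`, so vertices that decide in different rounds agree.
  chosen-selected : ∀ {t v w} → T ≤ t → G v w ≡ true →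
                    V.chosen (suc t) v t (toℕ w) ≡ selectedBool v w ∨ selectedBool w v
  chosen-selected {t} {v} {w} T≤t Gvw = cong₂ _∨_
    (cong₂ _∧_ (token-constant v (m≤n⇒m≤1+n T≤t)) (cong₂ _∧_
      (cong (λ a → does (a ℕ.≟ toℕ w)) (aim-constant v (m≤n⇒m≤1+n T≤t)))
      (cong (λ k → not (does (k ℕ.≟ toℕ v))) (trans (cong name (heard ≤-refl Gvw)) (name-X t w)))))
    (cong₂ _∧_ (trans (cong token (heard ≤-refl Gvw)) (token-constant w T≤t)) (cong₂ _∧_
      (cong (λ a → does (a ℕ.≟ toℕ v)) (trans (cong aim (heard ≤-refl Gvw)) (aim-constant w T≤t)))
      (cong (λ k → not (does (k ℕ.≟ toℕ w))) (parentName-local v {H (suc t) v}))))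

  selectedBool⁻ : ∀ {x w} → selectedBool x w ≡ true →
                  Selected (λ v → aim (X T v)) (λ v → token (X T v)) x w
  selectedBool⁻ {x} {w} e =
    ∧-conicalˡ (token (X T x)) _ e ,
    does-true (aim (X T x) ℕ.≟ toℕ w) (∧-conicalˡ _ _ e') ,
    λ pw≡x → not-true (dec-true (toℕ (parent w) ℕ.≟ toℕ x) (cong toℕ pw≡x)) (∧-conicalʳ (does (aim (X T x) ℕ.≟ toℕ w)) _ e')
    where
    e' = ∧-conicalʳ (token (X T x)) _ e

    not-true : ∀ {b} → b ≡ true → not b ≢ true
    not-true refl ()

  selectedBool⁺ : ∀ {x w} → Selected (λ v → aim (X T v)) (λ v → token (X T v)) x w →
                  selectedBool x w ≡ true
  selectedBool⁺ {x} {w} (tok , tgt , np) = cong₂ _∧_ tok (cong₂ _∧_ (dec-true (_ ℕ.≟ _) tgt)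
    (cong not (dec-false (toℕ (parent w) ℕ.≟ toℕ x) (np ∘ toℕ-injective))))

  private
    best inh : Fin n → ℕ
    best v = reach (X T v)
    inh v  = V.inherited (suc T) v T

    -- The optimum over the gains at round `T` is reported in round `suc T`; stability identifies it
    -- with the report of round `T`.
    best-optimum : ∀ v → best v ≡ reach (X (suc T) v)
    best-optimum v = sym (reach-stable (stable-from v settled≤T))

    gain-best : ∀ {v w} → G v w ≡ true → V.gain (suc T) v T (toℕ w) ≤ best v
    gain-best {v} {w} Gvw = subst (V.gain (suc T) v T (toℕ w) ≤_) (sym (best-optimum v))
      (optimum-≥ (V.gain (suc T) v T) _ (adjacent-∈ {K = H T v} Gvw))

    best-attained : ∀ {v} → 0 < best v →
                    ∃ λ u → G v u ≡ true × aim (X T v) ≡ toℕ u × best v ≡ V.gain (suc T) v T (toℕ u)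
    best-attained {v} pos with optimum-attained (V.gain (suc T) v T) _ (subst (0 <_) (best-optimum v) pos)
    ... | k , k∈ , e with ∈-adjacent {K = H T v} k∈
    ... | u , Gvu , refl = u , Gvu , trans (sym (aim-stable (stable-from v settled≤T))) (cong proj₂ e) ,
                           trans (best-optimum v) (cong proj₁ e)

    cover-optimum : ∀ v → coverage (X T v) ≡ (if does (inh v ℕ.≟ 0) then best v else inh v)
    cover-optimum v = trans (sym (coverage-stable (stable-from v settled≤T)))
      (cong (λ b → if does (inh v ℕ.≟ 0) then b else inh v) (sym (best-optimum v)))

    token-eq : ∀ {v} → v ≢ r → token (X T v) ≡
               does (inh v ℕ.≟ 0) ∨ (token (X T (parent v)) ∧ does (aim (X T (parent v)) ℕ.≟ toℕ v))
    token-eq {v} v≢r = trans (sym (token-stable-from v ≤-refl)) (token-other v≢r)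

  greedy : Greedy
  greedy = record
    { best      = best
    ; cover     = λ v → coverage (X T v)
    ; inherited = inh
    ; target    = λ v → aim (X T v)
    ; token     = λ v → token (X T v)
    ; best-link = λ {v} {w} {i} → link {v} {w} {i}
    ; best-child = λ { child@(_ , pc≡v) → subst (_≤ _) (gain-child (child-adjacent child) pc≡v)
                                                (gain-best (child-adjacent child)) }
    ; best-attained = attained
    ; inherited-child = λ { {c} {v} child@(_ , pc≡v) →
        subst (_≤ inh v) (inheritance-child (child-adjacent child) pc≡v)
          (optimum-≥ (V.inheritance (suc T) v T) _ (adjacent-∈ {K = H T v} (child-adjacent child))) }
    ; inherited-attained = inherits
    ; cover-chosen = λ {v} inh≡0 → trans (cover-optimum v) (if-true (dec-true (inh v ℕ.≟ 0) inh≡0))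
    ; cover-inherited = λ {v} pos →
        trans (cover-optimum v) (if-false (dec-false (inh v ℕ.≟ 0) (λ inh≡0 → <⇒≢ pos (sym inh≡0))))
    ; token-critical = λ {v} v≢r inh≡0 →
        trans (token-eq v≢r) (cong
        (_∨ (token (X T (parent v)) ∧ does (aim (X T (parent v)) ℕ.≟ toℕ v))) (dec-true (inh v ℕ.≟ 0) inh≡0))
    ; token-passed = λ { {c} (c≢r , refl) tok tgt → trans (token-eq c≢r)
        (trans (cong (does (inh c ℕ.≟ 0) ∨_) (cong₂ _∧_ tok (dec-true (_ ℕ.≟ _) tgt))) (∨-zeroʳ _)) }
    ; token-origin = origin
    }
    where
    link : ∀ {v w i} → G v w ≡ true → w ≢ parent v → parent w ≢ v →
           ¬ Ancestor parent (up parent i v) w → i < best v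
    link {v} {w} {i} Gvw w≢pv pw≢v ¬anc = <-≤-trans
      -- Were the reach at most `i`, the vertex `up parent i v` would be at or above the lowest
      -- common ancestor, hence an ancestor of `w`.
      (≰⇒> λ k≤i → ¬anc (ancestor-trans parent (up-ancestor parent k≤i v) (proj₁ (link-reaches h≤T Gvw))))
      (subst (_≤ best v) (gain-link Gvw pw≢v w≢pv) (gain-best Gvw))

    attained : ∀ {v} → 0 < best v →
      (∃ λ c → Child c v × aim (X T v) ≡ toℕ c × best v ≡ pred (best c)) ⊎
      (∃ λ w → G v w ≡ true × w ≢ parent v × parent w ≢ v × aim (X T v) ≡ toℕ w ×
               (∀ {i} → i < best v → ¬ Ancestor parent (up parent i v) w))
    attained {v} pos with best-attained pos
    ... | u , Gvu , tgt , e with parent u ≟ v | u ≟ parent v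
    ... | yes pu≡v | _        = inj₁ (u , adjacent-child Gvu pu≡v , tgt , trans e (gain-child Gvu pu≡v))
    ... | no pu≢v  | yes u≡pv = contradiction (trans e (gain-parent Gvu pu≢v u≡pv)) (>⇒≢ pos)
    ... | no pu≢v  | no u≢pv  = inj₂ (u , Gvu , u≢pv , pu≢v , tgt ,
      λ {i} i<b → proj₂ (link-reaches h≤T Gvu) (subst (i <_) (trans e (gain-link Gvu pu≢v u≢pv)) i<b))

    inherits : ∀ {v} → 0 < inh v → ∃ λ c → Child c v × inh v ≡ pred (coverage (X T c))
    inherits {v} pos with optimum-attained (V.inheritance (suc T) v T) _ pos
    ... | k , k∈ , e with ∈-adjacent {K = H T v} k∈
    ... | u , Gvu , refl with parent u ≟ v
    ... | yes pu≡v = u , adjacent-child Gvu pu≡v , trans (cong proj₁ e) (inheritance-child Gvu pu≡v)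
    ... | no pu≢v  = contradiction (trans (cong proj₁ e) (inheritance-other Gvu pu≢v)) (>⇒≢ pos)

    origin : ∀ {v} → token (X T v) ≡ true →
      v ≢ r × (inh v ≡ 0 ⊎ (token (X T (parent v)) ≡ true × aim (X T (parent v)) ≡ toℕ v))
    origin {v} tok = v≢r , split (trans (sym (token-eq v≢r)) tok)
      where
      v≢r : v ≢ r
      v≢r refl with () ← trans (sym tok) (token-root T)

      split : does (inh v ℕ.≟ 0) ∨ (token (X T (parent v)) ∧ does (aim (X T (parent v)) ℕ.≟ toℕ v)) ≡ true →
              inh v ≡ 0 ⊎ (token (X T (parent v)) ≡ true × aim (X T (parent v)) ≡ toℕ v)
      split e with does (inh v ℕ.≟ 0) in inh?
      ... | true  = inj₁ (does-true (inh v ℕ.≟ 0) inh?)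
      ... | false = inj₂ (∧-conicalˡ _ _ e , does-true (_ ℕ.≟ _) (∧-conicalʳ (token (X T (parent v))) _ e))

  -- Termination detection

  deepAt-run : ∀ {t s v} → s ≤ t → V.deepAt t v s ≡ deep (X s v)
  deepAt-run {s = zero}          _   = refl
  deepAt-run {t} {suc s} {v} s<t = any-cong λ k∈ → at (∈-adjacent {K = H t v} k∈)
    where
    at : ∀ {k} → (∃ λ u → G v u ≡ true × k ≡ toℕ u) →
         V.isChild t v s k ∧ deep (H t v s k) ≡ V.isChild (suc s) v s k ∧ deep (H (suc s) v s k)
    at (u , Gvu , refl) = cong (λ m → does (name m ℕ.≟ toℕ v) ∧ deep m)
                               (trans (heard s<t Gvu) (sym (heard ≤-refl Gvu)))

  deep-child : ∀ {t c v} → Child c v → deep (X t c) ≡ true → deep (X (suc t) v) ≡ true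
  deep-child {t} {v = v} child@(_ , pc≡v) e = any-true⁺ _ (adjacent-∈ {K = H t v} (child-adjacent child))
    (cong₂ _∧_ (isChild-true ≤-refl (child-adjacent child) pc≡v)
               (trans (cong deep (heard ≤-refl (child-adjacent child))) e))

  deep-shallow : ∀ t {v} → Shallow t v → deep (X t v) ≢ true
  deep-shallow (suc t) {v} sh e with any-true⁻ _ (V.neighbourIds (suc t) v) e
  ... | k , k∈ , e' with ∈-adjacent {K = H t v} k∈
  ... | u , Gvu , refl with parent u ≟ v
  ... | yes pu≡v = deep-shallow t (sh (adjacent-child Gvu pu≡v))
    (trans (sym (cong deep (heard ≤-refl Gvu))) (∧-conicalʳ (V.isChild (suc t) v t (toℕ u)) _ e'))
  ... | no pu≢v with () ← trans (sym (∧-conicalˡ _ _ e')) (isChild-false ≤-refl Gvu pu≢v)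

  deep-depth : ∀ {v d} t → Depth parent r v d → deep (X t v) ≡ true → deep (X (t + d) r) ≡ true
  deep-depth t root                   e = subst (λ t → deep (X t r) ≡ true) (sym (+-identityʳ t)) e
  deep-depth t (step {d = d} v≢r p) e = subst (λ t → deep (X t r) ≡ true) (sym (+-suc t d))
    (deep-depth (suc t) p (deep-child (v≢r , refl) e))

  depth-attained : ∀ {v d t} → t ≤ d → Depth parent r v d → ∃ λ u → Depth parent r u t
  depth-attained {v} {d} {t} t≤d p = _ , subst (Depth parent r _) (m∸[m∸n]≡n t≤d) (up-depth-∸ (m∸n≤m d t) p)

  -- Some ancestor of a deepest vertex has depth exactly `t`. Its signal of round 0 climbs one level
  -- per round and arrives in round `t`.
  deep-root : ∀ {t} → t ≤ h → deep (X t r) ≡ true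
  deep-root t≤h = deep-depth 0 (proj₂ (depth-attained t≤h (proj₂ (proj₂ height)))) refl

  done-root : ∀ t → done (X (suc t) r) ≡ not (deep (X (suc t) r))
  done-root t = if-true (isRoot-root (suc t))

  done-other : ∀ {t v} → v ≢ r → done (X (suc t) v) ≡ done (X t (parent v))
  done-other {t} v≢r = trans (if-false (isRoot-other (suc t) v≢r)) (cong done (heard-parent ≤-refl v≢r))

  -- The root hears of no descendant in any round after `h`, and its signal takes `d` further rounds
  -- down to depth `d`.
  done-eventually : ∀ {v d} t → Depth parent r v d → h + d < t → done (X t v) ≡ true
  done-eventually (suc t) root h<t = trans (done-root t) (cong not (not-true (deep-shallow (suc t)
    (shallow bound (suc t) root (≤-trans (s≤s (m≤m+n h 0)) h<t)))))
    where
    not-true : ∀ {b} → b ≢ true → b ≡ false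
    not-true {true}  b≢true = contradiction refl b≢true
    not-true {false} _      = refl
  done-eventually {d = suc d} (suc t) (step v≢r p) h+d<t =
    trans (done-other v≢r) (done-eventually t p (s≤s⁻¹ (subst (_< suc t) (+-suc h d) h+d<t)))

  -- The signal originates at the root in a round beyond the height, and passing it down only adds
  -- rounds.
  done-late : ∀ t {v} → done (X t v) ≡ true → h < t
  done-late zero    ()
  done-late (suc t) {v} e = split (v ≟ r)
    where
    split : Dec (v ≡ r) → h < suc t
    split (no v≢r)   = m≤n⇒m≤1+n (done-late t (trans (sym (done-other v≢r)) e))
    split (yes refl) = ≰⇒> λ t<h → deep⇒not-done (deep-root t<h) (trans (sym (done-root t)) e)
      where
      deep⇒not-done : ∀ {b} → b ≡ true → not b ≢ true
      deep⇒not-done refl ()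

  -- The algorithm evaluates the detection for a round `s` long past; the messages up to then are
  -- the same in the later history.
  doneAt-run : ∀ {t s} v → s ≤ t → V.doneAt t v s ≡ done (X s v)
  doneAt-run {s = zero}  v _   = refl
  doneAt-run {t} {suc s} v s<t = split (v ≟ r)
    where
    split : Dec (v ≡ r) → V.doneAt t v (suc s) ≡ done (X (suc s) v)
    split (yes refl) = trans (if-true (isRoot-root t))
                             (trans (cong not (deepAt-run s<t)) (sym (done-root s)))
    split (no v≢r)   = trans (if-false (isRoot-other t v≢r))
                             (trans (cong done (heard-parent s<t v≢r)) (sym (done-other v≢r)))

-- The run of the algorithm

module Execution {n : ℕ} {G : EdgeSet n} {r : Fin n} {parent : Fin n → Fin n} {h : ℕ}
                 (simple : IsSimpleGraph G) (tec : TwoEdgeConnected G)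
                 (tree : IsRootedSpanningTree G r parent) (height : IsHeight r parent h) where

  open RootedTree simple tree
  open LocalInputs simple tree

  S : ℕ → Fin n → State
  S = run algorithm G r parent

  H : ℕ → Fin n → History
  H t v = history (S t v)

  module V (t : ℕ) (v : Fin n) = View (local v) (H t v)

  X : ℕ → Fin n → Report
  X t v = V.report t v t

  input-run : ∀ t v → input (S t v) ≡ local v
  input-run zero    v = refl
  input-run (suc t) v = input-run t v

  time-run : ∀ t v → time (S t v) ≡ t
  time-run zero    v = refl
  time-run (suc t) v = cong suc (time-run t v)

  sent-run : ∀ t u k → Algorithm.send algorithm (S t u) k ≡ encode (width n) (X t u)
  sent-run t u k = cong₂ (λ i s → encode (width (LocalInput.numVertices i)) (View.report i (H t u) s))
                         (input-run t u) (time-run t u)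

  received : ℕ → Fin n → List (ℕ × Message)
  received t v = map (λ u → toℕ u , Algorithm.send algorithm (S t u) (toℕ v)) (neighbourList G v)

  history-run : ∀ t v s k → H (suc t) v s k ≡
                extend (H t v) t (lookupReport (width n) (received t v)) s k
  history-run t v s k =
    cong₂ (λ i s' → extend (H t v) s' (lookupReport (width (LocalInput.numVertices i)) (received t v)) s k)
          (input-run t v) (time-run t v)

  decision-run : ∀ t v → decision (S (suc t) v) ≡
                 decide (decision (S t v)) (V.doneAt (suc t) v (suc t / 4)) (V.chosen (suc t) v t)
  decision-run t v =
    cong₂ (λ i s → decide (decision (S t v)) (View.doneAt i (H (suc t) v) (suc s / 4))
                          (View.chosen i (H (suc t) v) s))
          (input-run t v) (time-run t v)

  lookup-sent : ∀ {w u us} (f : Fin n → Message) → u ∈ us →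
                lookupReport w (map (λ u → toℕ u , f u) us) (toℕ u) ≡ decode w (f u)
  lookup-sent {w} {u} {u' ∷ us} f u∈ with does (toℕ u' ℕ.≟ toℕ u) | proof (toℕ u' ℕ.≟ toℕ u)
  ... | true  | ofʸ e = cong (λ u → decode w (f u)) (toℕ-injective e)
  lookup-sent {us = u' ∷ us} f (here refl) | false | ofⁿ ne = contradiction refl ne
  lookup-sent {us = u' ∷ us} f (there u∈)  | false | _      = lookup-sent f u∈

  silence-bounded : Bounded n silence
  silence-bounded = record { name≤ = z≤n ; stream≤ = z≤n ; reach≤ = z≤n ; coverage≤ = z≤n ; aim≤ = z≤n }

  lookup-bounded : ∀ {w k} (f : Fin n → Message) us → (∀ u → Bounded n (decode w (f u))) →
                   Bounded n (lookupReport w (map (λ u → toℕ u , f u) us) k)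
  lookup-bounded         f []       f≤ = silence-bounded
  lookup-bounded {k = k} f (u ∷ us) f≤ with does (toℕ u ℕ.≟ k)
  ... | true  = f≤ u
  ... | false = lookup-bounded f us f≤

  toℕ-≤ : (v : Fin n) → toℕ v ≤ n
  toℕ-≤ v = <⇒≤ (toℕ<n v)

  report-bounded : ∀ {t v} → (∀ s k → Bounded n (H t v s k)) → Bounded n (X t v)
  report-bounded {t} {v} H≤ = View.report-bounded (local v) (H t v) (toℕ-≤ v)
    (subst (_≤ n) (sym (parentName-local v {H t v})) (toℕ-≤ (parent v)))
    (λ k∈ → ids≤ (∈-adjacent {K = H t v} k∈)) H≤ t
    where
    ids≤ : ∀ {k} → (∃ λ u → G v u ≡ true × k ≡ toℕ u) → k ≤ n
    ids≤ (u , _ , refl) = toℕ-≤ u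

  decode-sent : ∀ {t u} k → Bounded n (X t u) →
                decode (width n) (Algorithm.send algorithm (S t u) k) ≡ X t u
  decode-sent {t} {u} k b = trans (cong (decode (width n)) (sent-run t u k))
                                  (decode-encode (width n) (<-2^width n) b)

  -- Decoding is faithful only for values that fit their fields, so this bound is carried along by
  -- induction on the round before `heard` can be shown.
  history-bounded : ∀ t v s k → Bounded n (H t v s k)
  history-bounded zero    v s k = silence-bounded
  history-bounded (suc t) v s k = subst (Bounded n) (sym (history-run t v s k)) extended
    where
    extended : Bounded n (extend (H t v) t (lookupReport (width n) (received t v)) s k)
    extended with does (s ℕ.≟ t)
    ... | true  = lookup-bounded (λ u → Algorithm.send algorithm (S t u) (toℕ v)) (neighbourList G v)
                    (λ u → let b = report-bounded {t} {u} (history-bounded t u) in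
                           subst (Bounded n) (sym (decode-sent {t} {u} (toℕ v) b)) b)
    ... | false = history-bounded t v s k

  heard : ∀ {t v s u} → s < t → G v u ≡ true → H t v s (toℕ u) ≡ X s u
  heard {suc t} {v} {s} {u} s<1+t Gvu = trans (history-run t v s (toℕ u)) extended
    where
    extended : extend (H t v) t (lookupReport (width n) (received t v)) s (toℕ u) ≡ X s u
    extended with does (s ℕ.≟ t) | proof (s ℕ.≟ t)
    ... | true  | ofʸ refl = trans
      (lookup-sent (λ u → Algorithm.send algorithm (S t u) (toℕ v))
        (∈-filter⁺ (λ u → G v u Bool.≟ true) (∈-allFin u) Gvu))
      (decode-sent {t} {u} (toℕ v) (report-bounded {t} {u} (history-bounded t u)))
    ... | false | ofⁿ s≢t  = heard (≤∧≢⇒< (s≤s⁻¹ s<1+t) s≢t) Gvu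

  open Dynamics simple tree height H (λ {t} {v} → heard {t} {v})
    using (T; selectedBool; chosen-selected; selectedBool⁻; selectedBool⁺; greedy;
           doneAt-run; done-late; done-eventually)

  decided : ∀ t {v o} → decision (S t v) ≡ just o → ∃ λ s → T ≤ s × o ≡ V.chosen (suc s) v s
  decided (suc t) {v} {o} e = split _ (λ e → decided t {v} e) refl (trans (sym (decision-run t v)) e)
    where
    T≤t : V.doneAt (suc t) v (suc t / 4) ≡ true → T ≤ t
    T≤t done = s≤s⁻¹ (begin
      -- This is `suc T`; the detection guarantees `suc h ≤ suc t / 4`, so four times `suc h` rounds
      -- have passed.
      suc h + suc h + suc h  ≡⟨ +-assoc (suc h) (suc h) (suc h) ⟩
      suc h + (suc h + suc h) ≤⟨ +-monoʳ-≤ (suc h) (+-monoʳ-≤ (suc h) (m≤m+n (suc h) _)) ⟩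
      4 * suc h              ≡⟨ *-comm 4 (suc h) ⟩
      suc h * 4              ≤⟨ *-monoˡ-≤ 4 (done-late (suc t / 4) (trans (sym (doneAt-run v (m/n≤m (suc t) 4))) done)) ⟩
      suc t / 4 * 4          ≤⟨ m/n*n≤m (suc t) 4 ⟩
      suc t                  ∎)
      where open ≤-Reasoning

    split : ∀ d → (∀ {o} → d ≡ just o → ∃ λ s → T ≤ s × o ≡ V.chosen (suc s) v s) →
            ∀ {b} → V.doneAt (suc t) v (suc t / 4) ≡ b → decide d b (V.chosen (suc t) v t) ≡ just o →
            ∃ λ s → T ≤ s × o ≡ V.chosen (suc s) v s
    split (just _) earlier         _    refl = earlier refl
    split nothing  earlier {true}  done refl = t , T≤t done , refl

  decided-by : ∀ v → ∃ λ o → decision (S (8 * suc h) v) ≡ just o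
  -- `8 * suc h` computes to `suc (h + 7 * suc h)`. A quarter of it is `2 * suc h`, which exceeds
  -- `h + d` for every depth `d ≤ h`.
  decided-by v = _ , trans (decision-run (h + 7 * suc h) v) (proj₂ (decide-true _ _ done-now))
    where
    decide-true : ∀ d f {b} → b ≡ true → ∃ λ o → decide d b f ≡ just o
    decide-true (just o) f _    = o , refl
    decide-true nothing  f refl = f , refl

    quarter : 8 * suc h / 4 ≡ 2 * suc h
    quarter = trans (cong (_/ 4) (trans (*-assoc 4 2 (suc h)) (*-comm 4 (2 * suc h))))
                    (m*n/n≡m (2 * suc h) 4)

    done-now : V.doneAt (8 * suc h) v (8 * suc h / 4) ≡ true
    done-now with reaches-root v
    ... | d , p = trans (doneAt-run v (m/n≤m (8 * suc h) 4))
      (subst (λ s → done (X s v) ≡ true) (sym quarter) (done-eventually (2 * suc h) p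
        (s≤s (+-monoʳ-≤ h (≤-trans (proj₁ height v d p) (≤-trans (n≤1+n h) (m≤m+n (suc h) 0)))))))

  irrevocable : Irrevocable algorithm G r parent
  irrevocable t t' v o t≤t' e with m≤n⇒∃[o]m+o≡n t≤t'
  ... | k , refl = go k
    where
    decide-just : ∀ {d b f} → d ≡ just o → decide d b f ≡ just o
    decide-just refl = refl

    go : ∀ k → decision (S (t + k) v) ≡ just o
    go zero    = trans (cong (λ t → decision (S t v)) (+-identityʳ t)) e
    go (suc k) = trans (cong (λ t → decision (S t v)) (+-suc t k))
      (trans (decision-run (t + k) v) (decide-just (go k)))

  bandwidth : Bandwidth algorithm G r parent 8
  bandwidth t u v _ = subst (λ m → length m ≤ 8 * width n) (sym (sent-run t u (toℕ v)))
                            (length-encode n (X t u))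

  solves : SolvesBy algorithm G r parent (8 * suc h)
  solves = o , (λ v → proj₂ (decided-by v)) , agree , approx
    where
    o : Fin n → ℕ → Bool
    o v = proj₁ (decided-by v)

    o-selected : ∀ {v w} → G v w ≡ true → o v (toℕ w) ≡ selectedBool v w ∨ selectedBool w v
    o-selected {v} {w} Gvw with decided (8 * suc h) {v} (proj₂ (decided-by v))
    ... | s , T≤s , e = trans (cong (λ f → f (toℕ w)) e) (chosen-selected T≤s Gvw)

    agree : ∀ u v → G u v ≡ true → o u (toℕ v) ≡ o v (toℕ u)
    agree u v Guv = trans (o-selected Guv) (trans (∨-comm (selectedBool u v) _)
                      (sym (o-selected (trans (symmetric v u) Guv))))

    approx : TwoApprox G r parent (λ u v → G u v ∧ o u (toℕ v))
    approx = selected-two-approx greedy tec (proj₁ height) A-symmetric A⇒selected selected⇒A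
      where
      A-symmetric : Symmetric (λ u v → G u v ∧ o u (toℕ v))
      A-symmetric u v = go _ refl
        where
        go : ∀ b → G u v ≡ b → G u v ∧ o u (toℕ v) ≡ G v u ∧ o v (toℕ u)
        go true  e = cong₂ _∧_ (symmetric u v) (agree u v e)
        go false e = trans (cong (_∧ o u (toℕ v)) e)
                           (sym (cong (_∧ o v (toℕ u)) (trans (symmetric v u) e)))

      split : ∀ {a b} → a ∨ b ≡ true → a ≡ true ⊎ b ≡ true
      split {true}  _ = inj₁ refl
      split {false} e = inj₂ e

      A⇒selected : ∀ {u v} → G u v ∧ o u (toℕ v) ≡ true →
                   G u v ≡ true × (Selected (Greedy.target greedy) (Greedy.token greedy) u v ⊎
                                   Selected (Greedy.target greedy) (Greedy.token greedy) v u)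
      A⇒selected {u} {v} e = Guv , Sum.map selectedBool⁻ selectedBool⁻
        (split (trans (sym (o-selected Guv)) (∧-conicalʳ (G u v) _ e)))
        where Guv = ∧-conicalˡ (G u v) _ e

      selected⇒A : ∀ {u v} → G u v ≡ true → Selected (Greedy.target greedy) (Greedy.token greedy) u v →
                   G u v ∧ o u (toℕ v) ≡ true
      selected⇒A {u} {v} Guv sel = cong₂ _∧_ Guv
        (trans (o-selected Guv) (cong (_∨ selectedBool v u) (selectedBool⁺ sel)))

theorem6 :
    ∃ λ (A : Algorithm) → ∃ λ (B : ℕ) → ∃ λ (C : ℕ) →
      ∀ (n : ℕ) (G : EdgeSet n) (r : Fin n) (parent : Fin n → Fin n) (h : ℕ) →
        IsSimpleGraph G → TwoEdgeConnected G →
        IsRootedSpanningTree G r parent → IsHeight r parent h →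
          Bandwidth A G r parent B × Irrevocable A G r parent ×
          SolvesBy A G r parent (C * suc h)
theorem6 = algorithm , 8 , 8 , λ n G r parent h simple tec tree height →
  let open Execution simple tec tree height in bandwidth , irrevocable , solves
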